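{- Let $N\ge 3$, $1\le r\le N$, let $R$ be a set of $r$ rim vertices of the wheel graph $W_{N+1}$ with central vertex $c$, and let $d_1,\ldots,d_r$ be the cyclic intervals of $R$. Then $$\mathcal F_{W_{N+1}}(\{c\}\cup R)=\prod_{i=1}^{r}m(P_{2d_i-1}),$$ where $m(P_n)$ denotes the number of matchings of the path graph $P_n$ on $n$ vertices.
   Context: The wheel graph $W_{N+1}$ ($N\ge3$) has vertex set $\{c,v_1,\ldots,v_N\}$ and edges $\{v_i,v_{i+1}\}$ (indices modulo $N$) and $\{c,v_i\}$ for $1\le i\le N$; $c$ is the central vertex and the $v_i$ are the rim vertices. For a set $R=\{v_{a_1},\ldots,v_{a_r}\}$ of rim vertices with $1\le a_1<\cdots<a_r\le N$, the cyclic intervals are $d_i=a_{i+1}-a_i$ for $1\le i\le r-1$ and $d_r=a_1+N-a_r$. For a finite connected graph $G$ and $\varnothing\ne S\subseteq V(G)$, a rooted spanning forest of $G$ with root set $S$ is a spanning forest (an acyclic subgraph containing all vertices of $G$) in which each connected component contains exactly one vertex of $S$; $\mathcal F_G(S)$ denotes the number of such forests. A matching of a graph is a set of edges no two of which share an endpoint; the empty set is a matching. -}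

module Defs where

open import Data.Empty using (⊥-elim)
open import Data.Fin.Base using (Fin; zero; suc; toℕ; inject₁; splitAt; join; fromℕ<)
import Data.Fin.Properties as Finₚ
open import Data.Fin.Subset using (Subset; inside; outside; _∈_)
open import Data.Fin.Subset.Properties using (_∈?_)
open import Data.List.Base using (List; []; _∷_; _++_; map; filter; length; allFin)
open import Data.List.Membership.Propositional using () renaming (_∈_ to _∈ˡ_)
open import Data.List.Membership.Propositional.Properties using (∈-allFin)
open import Data.List.Relation.Unary.Any using (here; there)
open import Data.Nat.Base using (ℕ; zero; suc; _+_; _∸_; _≤_; _<_; _%_; s≤s)
open import Data.Nat.DivMod using (_mod_; m<n⇒m%n≡m; n%n≡0)
import Data.Nat.Properties as ℕₚ
open import Data.Product using (∃; ∃!; ∃-syntax; _×_; _,_; proj₁; proj₂)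
open import Data.Product.Properties using (≡-dec; ,-injectiveˡ; ,-injectiveʳ)
open import Data.Sum.Base using (_⊎_; inj₁; inj₂)
open import Data.Vec.Base using (Vec; []; _∷_; lookup)
open import Function.Definitions using (Injective)
open import Relation.Binary.Construct.Closure.ReflexiveTransitive using (Star; ε; _◅_; _◅◅_)
open import Relation.Binary.PropositionalEquality
open import Relation.Nullary.Decidable
  using (Dec; map′; _×-dec_; _⊎-dec_; _→-dec_; ¬?)
open import Relation.Nullary.Negation using (¬_)
open import Relation.Unary using (Decidable)

private
  variable
    n k : ℕ

next : Fin n → Fin n
next {suc n} i = suc (toℕ i) mod suc n

Joins : Fin n × Fin n → Fin n → Fin n → Set
Joins p u v = p ≡ (u , v) ⊎ p ≡ (v , u)

-- A finite simple graph.  The edges are listed without repetition, so that a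
-- set of edges is a Subset size; `ends e` is an unordered pair written in an
-- arbitrary order.
record Graph : Set where
  field
    order    : ℕ
    size     : ℕ
    ends     : Fin size → Fin order × Fin order
    loopless : ∀ e v → ends e ≢ (v , v)
    simple   : ∀ {e f u v} → Joins (ends e) u v → Joins (ends f) u v → e ≡ f

  Vertex Edge : Set
  Vertex = Fin order
  Edge   = Fin size

  Endpoint : Vertex → Edge → Set
  Endpoint v e = v ≡ proj₁ (ends e) ⊎ v ≡ proj₂ (ends e)

-- A set F of edges is identified with the spanning subgraph having edge set F.

module _ (G : Graph) where
  open Graph G

  Adjacent : Subset size → Vertex → Vertex → Set
  Adjacent F u v = ∃[ e ] e ∈ F × Joins (ends e) u v

  Connected : Subset size → Vertex → Vertex → Set
  Connected F = Star (Adjacent F)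

  IsCycle : Subset size → Vec Vertex k → Set
  IsCycle {k} F x = 3 ≤ k × Injective _≡_ _≡_ (lookup x)
                  × (∀ i → Adjacent F (lookup x i) (lookup x (next i)))

  Acyclic : Subset size → Set
  Acyclic F = ¬ (∃[ k ] ∃[ x ] IsCycle {k} F x)

  -- Each component is the component of some vertex v, so the second condition
  -- says that each component contains exactly one vertex of S.
  IsRootedForest : Subset order → Subset size → Set
  IsRootedForest S F =
    Acyclic F × (∀ v → ∃! _≡_ λ s → s ∈ S × Connected F v s)

  IsMatching : Subset size → Set
  IsMatching M = ∀ e f → e ∈ M → f ∈ M →
                 ∀ v → Endpoint v e → Endpoint v f → e ≡ f

any-vec? : {P : Vec (Fin n) k → Set} → Decidable P → Dec (∃ P)
any-vec? {k = zero}  P? = map′ ([] ,_) (λ { ([] , p) → p }) (P? [])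
any-vec? {k = suc k} P? =
  map′ (λ { (x , xs , p) → x ∷ xs , p }) (λ { (x ∷ xs , p) → x , xs , p })
       (Finₚ.any? λ x → any-vec? λ xs → P? (x ∷ xs))

-- Warshall's algorithm: Via R xs u v says that v can be reached from u
-- through intermediate vertices taken from xs.
module _ {R : Fin n → Fin n → Set} where

  Via : List (Fin n) → Fin n → Fin n → Set
  Via []       u v = u ≡ v ⊎ R u v
  Via (x ∷ xs) u v = Via xs u v ⊎ Via xs u x × Via xs x v

  via-base : ∀ xs {u v} → u ≡ v ⊎ R u v → Via xs u v
  via-base []       p = p
  via-base (x ∷ xs) p = inj₁ (via-base xs p)

  via-to : ∀ {x xs u} → Via (x ∷ xs) u x → Via xs u x
  via-to (inj₁ p)       = p
  via-to (inj₂ (p , _)) = p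

  via-from : ∀ {x xs v} → Via (x ∷ xs) x v → Via xs x v
  via-from (inj₁ p)       = p
  via-from (inj₂ (_ , p)) = p

  via-trans : ∀ {xs u y v} → y ∈ˡ xs → Via xs u y → Via xs y v → Via xs u v
  via-trans (here refl) p q = inj₂ (via-to p , via-from q)
  via-trans (there m) (inj₁ p)         (inj₁ q)         = inj₁ (via-trans m p q)
  via-trans (there m) (inj₁ p)         (inj₂ (q₁ , q₂)) = inj₂ (via-trans m p q₁ , q₂)
  via-trans (there m) (inj₂ (p₁ , p₂)) (inj₁ q)         = inj₂ (p₁ , via-trans m p₂ q)
  via-trans (there m) (inj₂ (p₁ , _))  (inj₂ (_ , q₂))  = inj₂ (p₁ , q₂)

  star⇒via : ∀ {u v} → Star R u v → Via (allFin n) u v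
  star⇒via ε       = via-base (allFin n) (inj₁ refl)
  star⇒via (r ◅ s) =
    via-trans (∈-allFin _) (via-base (allFin n) (inj₂ r)) (star⇒via s)

  via⇒star : ∀ xs {u v} → Via xs u v → Star R u v
  via⇒star []       (inj₁ refl)    = ε
  via⇒star []       (inj₂ r)       = r ◅ ε
  via⇒star (x ∷ xs) (inj₁ p)       = via⇒star xs p
  via⇒star (x ∷ xs) (inj₂ (p , q)) = via⇒star xs p ◅◅ via⇒star xs q

  module _ (R? : ∀ u v → Dec (R u v)) where

    via? : ∀ xs u v → Dec (Via xs u v)
    via? []       u v = (u Finₚ.≟ v) ⊎-dec R? u v
    via? (x ∷ xs) u v = via? xs u v ⊎-dec (via? xs u x ×-dec via? xs x v)

    star? : ∀ u v → Dec (Star R u v)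
    star? u v = map′ (via⇒star (allFin n)) star⇒via (via? (allFin n) u v)

module _ (G : Graph) where
  open Graph G

  adjacent? : ∀ F u v → Dec (Adjacent G F u v)
  adjacent? F u v = Finₚ.any? λ e →
    (e ∈? F) ×-dec ((ends e ≟ (u , v)) ⊎-dec (ends e ≟ (v , u)))
    where _≟_ = ≡-dec Finₚ._≟_ Finₚ._≟_

  connected? : ∀ F u v → Dec (Connected G F u v)
  connected? F = star? (adjacent? F)

  isCycle? : ∀ F → Decidable (IsCycle G {k} F)
  isCycle? {k} F x =
    (3 ℕₚ.≤? k)
    ×-dec map′ (λ h {i} {j} → h i j) (λ h i j → h {i} {j})
            (Finₚ.all? λ i → Finₚ.all? λ j →
              (lookup x i Finₚ.≟ lookup x j) →-dec (i Finₚ.≟ j))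
    ×-dec (Finₚ.all? λ i → adjacent? F (lookup x i) (lookup x (next i)))

  acyclic? : Decidable (Acyclic G)
  acyclic? F = ¬? (map′
    (λ { (k , x , c) → toℕ k , x , c })
    (λ { (k , x , c) → bound x c (s≤s (Finₚ.injective⇒≤ (proj₁ (proj₂ c)))) })
    (Finₚ.any? {suc order} λ k → any-vec? {k = toℕ k} (isCycle? F)))
    where
    bound : ∀ {k} (x : Vec Vertex k) → IsCycle G F x → k < suc order →
            ∃[ j ] ∃[ y ] IsCycle G {toℕ {suc order} j} F y
    bound {k} x c k< =
      fromℕ< k< ,
      subst (λ l → ∃[ y ] IsCycle G {l} F y) (sym (Finₚ.toℕ-fromℕ< k<)) (x , c)

  isRootedForest? : ∀ S → Decidable (IsRootedForest G S)
  isRootedForest? S F = acyclic? F ×-dec Finₚ.all? λ v →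
    Finₚ.any? λ s → root? v s ×-dec
      map′ (λ h {t} → h t) (λ h t → h {t})
           (Finₚ.all? λ t → root? v t →-dec (s Finₚ.≟ t))
    where
    root? : ∀ v s → Dec (s ∈ S × Connected G F v s)
    root? v s = (s ∈? S) ×-dec connected? F v s

  isMatching? : Decidable (IsMatching G)
  isMatching? M = Finₚ.all? λ e → Finₚ.all? λ f →
    (e ∈? M) →-dec ((f ∈? M) →-dec
      Finₚ.all? λ v → endpoint? v e →-dec (endpoint? v f →-dec (e Finₚ.≟ f)))
    where
    endpoint? : ∀ v e → Dec (Endpoint v e)
    endpoint? v e = (v Finₚ.≟ proj₁ (ends e)) ⊎-dec (v Finₚ.≟ proj₂ (ends e))

subsets : ∀ n → List (Subset n)
subsets zero    = [] ∷ []
subsets (suc n) = map (outside ∷_) (subsets n) ++ map (inside ∷_) (subsets n)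

count : {P : Subset n → Set} → Decidable P → ℕ
count P? = length (filter P? (subsets _))

𝓕 : (G : Graph) → Subset (Graph.order G) → ℕ
𝓕 G S = count (isRootedForest? G S)

m : Graph → ℕ
m G = count (isMatching? G)

pathEnds : Fin n → Fin (suc n) × Fin (suc n)
pathEnds i = inject₁ i , suc i

inject₁≢suc : (i : Fin n) → inject₁ i ≢ suc i
inject₁≢suc i eq =
  ℕₚ.1+n≢n (sym (trans (sym (Finₚ.toℕ-inject₁ i)) (cong toℕ eq)))

path-crossed : {i j : Fin n} {u v : Fin (suc n)} →
               pathEnds i ≡ (u , v) → pathEnds j ≢ (v , u)
path-crossed {i = i} {j} refl q = ℕₚ.<-asym {toℕ i} {toℕ j} i<j j<i
  where
  i<j : toℕ i < toℕ j
  i<j = ℕₚ.≤-reflexive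
    (trans (sym (cong toℕ (,-injectiveˡ q))) (Finₚ.toℕ-inject₁ j))
  j<i : toℕ j < toℕ i
  j<i = ℕₚ.≤-reflexive
    (trans (cong toℕ (,-injectiveʳ q)) (Finₚ.toℕ-inject₁ i))

path : ℕ → Graph
path zero = record
  { order = 0 ; size = 0 ; ends = λ () ; loopless = λ () ; simple = λ { {()} } }
path (suc n) = record
  { order    = suc n
  ; size     = n
  ; ends     = pathEnds
  ; loopless = λ e v eq → inject₁≢suc e (trans (,-injectiveˡ eq) (sym (,-injectiveʳ eq)))
  ; simple   = simple′
  }
  where
  simple′ : {i j : Fin n} {u v : Fin (suc n)} →
            Joins (pathEnds i) u v → Joins (pathEnds j) u v → i ≡ j
  simple′ (inj₁ p) (inj₁ q) = Finₚ.suc-injective (,-injectiveʳ (trans p (sym q)))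
  simple′ (inj₁ p) (inj₂ q) = ⊥-elim (path-crossed p q)
  simple′ (inj₂ p) (inj₁ q) = ⊥-elim (path-crossed p q)
  simple′ (inj₂ p) (inj₂ q) = Finₚ.suc-injective (,-injectiveʳ (trans p (sym q)))

-- In wheel N, vertex 0 is the centre c, and vertex i is the rim vertex v_i for
-- 1 ≤ i ≤ N.
centre : Fin (suc n)
centre = zero

-- The first N edges form the rim, the last N are the spokes.
wheelEnds : ∀ N → Fin (N + N) → Fin (suc N) × Fin (suc N)
wheelEnds N e with splitAt N e
... | inj₁ i = suc i , suc (next i)
... | inj₂ i = centre , suc i

next-cases : (i : Fin n) → toℕ (next i) ≡ suc (toℕ i)
                         ⊎ toℕ (next i) ≡ 0 × suc (toℕ i) ≡ n
next-cases {suc n} i with ℕₚ.m≤n⇒m<n∨m≡n (Finₚ.toℕ<n i)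
... | inj₁ i+1<n = inj₁ (trans (Finₚ.toℕ-fromℕ< _) (m<n⇒m%n≡m i+1<n))
... | inj₂ i+1≡n = inj₂
  ( trans (Finₚ.toℕ-fromℕ< _) (trans (cong (_% suc n) i+1≡n) (n%n≡0 (suc n)))
  , i+1≡n )

next≢ : 2 ≤ n → (i : Fin n) → next i ≢ i
next≢ 2≤n i eq with next-cases i
... | inj₁ p = ℕₚ.1+n≢n (trans (sym p) (cong toℕ eq))
... | inj₂ (p , q) =
  ℕₚ.<⇒≢ 2≤n (trans (cong suc (trans (sym p) (cong toℕ eq))) q)

next²≢ : 3 ≤ n → (i : Fin n) → next (next i) ≢ i
next²≢ 3≤n i eq with next-cases i | next-cases (next i)
... | inj₁ p | inj₁ q =
  ℕₚ.<⇒≢ (ℕₚ.m≤n+m (suc (toℕ i)) 1) (trans (sym (cong toℕ eq)) (trans q (cong suc p)))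
... | inj₁ p | inj₂ (q , s) =
  ℕₚ.<⇒≢ 3≤n (trans (cong (2 +_) (trans (sym q) (cong toℕ eq))) (trans (sym (cong suc p)) s))
... | inj₂ (p , s) | inj₁ q =
  ℕₚ.<⇒≢ 3≤n (trans (cong suc (trans (sym (trans q (cong suc p))) (cong toℕ eq))) s)
... | inj₂ (p , _) | inj₂ (_ , s) =
  ℕₚ.<⇒≢ (ℕₚ.<⇒≤ 3≤n) (trans (sym (cong suc p)) s)

module _ (N : ℕ) (3≤N : 3 ≤ N) where
  private
    loopless′ : ∀ e v → wheelEnds N e ≢ (v , v)
    loopless′ e v eq with splitAt N e
    ... | inj₁ i = next≢ (ℕₚ.<⇒≤ 3≤N) i
      (Finₚ.suc-injective (trans (,-injectiveʳ eq) (sym (,-injectiveˡ eq))))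
    ... | inj₂ i =
      Finₚ.0≢1+n (trans (,-injectiveˡ eq) (sym (,-injectiveʳ eq)))

    rim-crossed : ∀ {i j : Fin N} {u v : Fin (suc N)} →
      (suc i , suc (next i)) ≡ (u , v) → (suc j , suc (next j)) ≢ (v , u)
    rim-crossed {i} {j} refl q = next²≢ 3≤N i
      (trans (cong next (sym (Finₚ.suc-injective (,-injectiveˡ q))))
             (Finₚ.suc-injective (,-injectiveʳ q)))

    RimJoins : Fin N → Fin (suc N) → Fin (suc N) → Set
    RimJoins i = Joins (suc i , suc (next i))

    SpokeJoins : Fin N → Fin (suc N) → Fin (suc N) → Set
    SpokeJoins i = Joins (centre , suc i)

    rim-rim : ∀ {i j u v} → RimJoins i u v → RimJoins j u v → i ≡ j
    rim-rim (inj₁ p) (inj₁ q) = Finₚ.suc-injective (,-injectiveˡ (trans p (sym q)))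
    rim-rim (inj₁ p) (inj₂ q) = ⊥-elim (rim-crossed p q)
    rim-rim (inj₂ p) (inj₁ q) = ⊥-elim (rim-crossed p q)
    rim-rim (inj₂ p) (inj₂ q) = Finₚ.suc-injective (,-injectiveˡ (trans p (sym q)))

    spoke-spoke : ∀ {i j u v} → SpokeJoins i u v → SpokeJoins j u v → i ≡ j
    spoke-spoke (inj₁ refl) (inj₁ refl) = refl
    spoke-spoke (inj₁ refl) (inj₂ ())
    spoke-spoke (inj₂ refl) (inj₁ ())
    spoke-spoke (inj₂ refl) (inj₂ refl) = refl

    rim-spoke : ∀ {i j u v} → RimJoins i u v → ¬ SpokeJoins j u v
    rim-spoke (inj₁ refl) (inj₁ ())
    rim-spoke (inj₁ refl) (inj₂ ())
    rim-spoke (inj₂ refl) (inj₁ ())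
    rim-spoke (inj₂ refl) (inj₂ ())

    simple′ : ∀ {e f u v} →
      Joins (wheelEnds N e) u v → Joins (wheelEnds N f) u v → e ≡ f
    simple′ {e} {f} {u} {v} p q = trans (sym (Finₚ.join-splitAt N N e))
      (trans (cong (join N N) (same p q)) (Finₚ.join-splitAt N N f))
      where
      same : Joins (wheelEnds N e) u v → Joins (wheelEnds N f) u v →
             splitAt N e ≡ splitAt N f
      same p q with splitAt N e | splitAt N f
      ... | inj₁ _ | inj₁ _ = cong inj₁ (rim-rim p q)
      ... | inj₁ _ | inj₂ _ = ⊥-elim (rim-spoke p q)
      ... | inj₂ _ | inj₁ _ = ⊥-elim (rim-spoke q p)
      ... | inj₂ _ | inj₂ _ = cong inj₂ (spoke-spoke p q)

  -- W_{N+1}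
  wheel : Graph
  wheel = record
    { order    = suc N
    ; size     = N + N
    ; ends     = wheelEnds N
    ; loopless = loopless′
    ; simple   = simple′
    }

-- In increasing order.
elements : Subset n → List (Fin n)
elements S = filter (_∈? S) (allFin _)

-- For a₁ < ⋯ < aᵣ: the list a₂ ∸ a₁, …, aᵣ ∸ aᵣ₋₁, (a₁ + N) ∸ aᵣ.
intervals : ℕ → List ℕ → List ℕ
intervals N []       = []
intervals N (a₁ ∷ as) = go a₁ as
  where
  go : ℕ → List ℕ → List ℕ
  go a []       = (a₁ + N) ∸ a ∷ []
  go a (b ∷ bs) = b ∸ a ∷ go b bs

-- R is meant to consist of rim vertices; toℕ of the vertex v_i is i itself.
cyclicIntervals : ∀ {N} → Subset (suc N) → List ℕ
cyclicIntervals {N} R = intervals N (map toℕ (elements R))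

-- Cut the rim at its missing edges.  A set of edges is a forest rooted at
-- {c} ∪ R exactly when every piece of the rim contains exactly one root, a root
-- being a vertex of R or a spoke.  A two-state automaton running once round the
-- rim checks this, so the number of forests is the trace of a product of 2 × 2
-- transfer matrices.  A vertex of R contributes a matrix of rank one, hence the
-- trace factors over the cyclic intervals, and the factor of an interval d
-- satisfies the recursion of m (P_{2d−1}).
--
-- For the equivalence, the states of a successful run orient every edge towards
-- its root with decreasing height, which excludes cycles and a second root.
-- Conversely, a failing run started at a vertex of R exhibits a cycle, two
-- connected roots, or a piece of the rim without root.

module Submission where

open import Defs
open import Data.Bool.Base using (Bool; true; false; _∧_; _∨_)
open import Data.Empty using (⊥; ⊥-elim)
open import Data.Fin.Base using (Fin; zero; suc; toℕ; inject₁; fromℕ; splitAt; _↑ˡ_; _↑ʳ_)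
import Data.Fin.Properties as Finₚ
open import Data.Fin.Subset
  using (Subset; inside; outside; _∈_; _∉_; ∣_∣; _∪_; ⁅_⁆; Nonempty)
open import Data.Fin.Subset.Properties using (_∈?_; nonempty?; Empty-unique; ∣⊥∣≡0; ∪-identityˡ)
open import Data.List.Base as List using (List; []; _∷_; map; filter; length; allFin)
import Data.List.Properties as Listₚ
open import Data.Maybe.Base using (Maybe; just; nothing; _>>=_)
open import Data.Nat.Base
  using (ℕ; zero; suc; _+_; _*_; _∸_; _%_; _≤_; _<_; z≤n; s≤s)
open import Data.Nat.DivMod
  using (_mod_; m%n<n; m<n⇒m%n≡m; m%n%n≡m%n; n%n≡0; %-distribˡ-+; [m+n]%n≡m%n)
open import Data.Nat.Induction using (<-wellFounded)
open import Data.Nat.ListAction using (product)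
import Data.Nat.Properties as ℕₚ
open import Data.Nat.Tactic.RingSolver using (solve-∀)
open import Data.Product using (∃; ∃-syntax; _×_; _,_; proj₁; proj₂)
open import Data.Sum.Base as Sum using (_⊎_; inj₁; inj₂)
open import Data.Vec.Base using ([]; _∷_; _++_; here; there; lookup; tabulate)
import Data.Vec.Properties as Vecₚ
open import Function.Base using (_∘_; id)
open import Function.Bundles using (_⇔_; mk⇔; Equivalence)
open import Function.Definitions using (Injective)
open import Induction.WellFounded using (Acc; acc)
open import Relation.Binary.Construct.Closure.ReflexiveTransitive as Star
  using (Star; ε; _◅_; _◅◅_)
open import Relation.Binary.PropositionalEquality
open import Relation.Nullary.Decidable using (Dec; does; yes; no; does-⇔; dec-false)
open import Relation.Nullary.Negation using (¬_; contradiction)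
open import Relation.Unary using (Decidable)

private
  variable
    n k : ℕ

-- Counting as summation over subsets

⟦_⟧ : Bool → ℕ
⟦ true ⟧  = 1
⟦ false ⟧ = 0

∑ : ∀ n → (Subset n → ℕ) → ℕ
∑ zero    f = f []
∑ (suc n) f = ∑ n (f ∘ (outside ∷_)) + ∑ n (f ∘ (inside ∷_))

∑-cong : ∀ n {f g : Subset n → ℕ} → f ≗ g → ∑ n f ≡ ∑ n g
∑-cong zero    f≗g = f≗g []
∑-cong (suc n) f≗g =
  cong₂ _+_ (∑-cong n (f≗g ∘ (outside ∷_))) (∑-cong n (f≗g ∘ (inside ∷_)))

∑-zero : ∀ n → ∑ n (λ _ → 0) ≡ 0
∑-zero zero    = refl
∑-zero (suc n) = cong₂ _+_ (∑-zero n) (∑-zero n)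

+-interchange : ∀ a b c d → (a + b) + (c + d) ≡ (a + c) + (b + d)
+-interchange = solve-∀

∑-+ : ∀ n (f g : Subset n → ℕ) → ∑ n (λ v → f v + g v) ≡ ∑ n f + ∑ n g
∑-+ zero    f g = refl
∑-+ (suc n) f g = trans
  (cong₂ _+_ (∑-+ n _ _) (∑-+ n _ _))
  (+-interchange (∑ n (f ∘ (outside ∷_))) (∑ n (g ∘ (outside ∷_))) _ _)

∑-++ : ∀ m (f : Subset (m + n) → ℕ) →
       ∑ (m + n) f ≡ ∑ m λ u → ∑ n λ v → f (u ++ v)
∑-++ zero    f = refl
∑-++ (suc m) f = cong₂ _+_ (∑-++ m _) (∑-++ m _)

-- The map `g` collects the prefixes that `subsets` adds by nested `map`s, so that the induction
-- hypothesis applies to both branches.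
length-filter-subsets : ∀ n {P : Subset k → Set} (P? : Decidable P) (g : Subset n → Subset k) →
  length (filter P? (map g (subsets n))) ≡ ∑ n (λ v → ⟦ does (P? (g v)) ⟧)
length-filter-subsets zero P? g with does (P? (g []))
... | true  = refl
... | false = refl
length-filter-subsets (suc n) P? g = begin
  length (filter P? (map g (map (outside ∷_) vs List.++ map (inside ∷_) vs)))
    ≡⟨ cong (length ∘ filter P?) (Listₚ.map-++ g (map (outside ∷_) vs) _) ⟩
  length (filter P? (map g (map (outside ∷_) vs) List.++ map g (map (inside ∷_) vs)))
    ≡⟨ cong length (Listₚ.filter-++ P? (map g (map (outside ∷_) vs)) _) ⟩
  length (filter P? (map g (map (outside ∷_) vs)) List.++ filter P? (map g (map (inside ∷_) vs)))
    ≡⟨ Listₚ.length-++ (filter P? (map g (map (outside ∷_) vs))) ⟩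
  length (filter P? (map g (map (outside ∷_) vs))) + length (filter P? (map g (map (inside ∷_) vs)))
    ≡⟨ cong₂ _+_ (branch outside) (branch inside) ⟩
  _ ∎
  where
  open ≡-Reasoning
  vs = subsets n
  branch : ∀ b → length (filter P? (map g (map (b ∷_) vs))) ≡
                 ∑ n (λ v → ⟦ does (P? (g (b ∷ v))) ⟧)
  branch b = trans (cong (length ∘ filter P?) (sym (Listₚ.map-∘ vs)))
                   (length-filter-subsets n P? (g ∘ (b ∷_)))

count≡∑ : {P : Subset n → Set} (P? : Decidable P) → count P? ≡ ∑ n (λ v → ⟦ does (P? v) ⟧)
count≡∑ P? = trans (cong (length ∘ filter P?) (sym (Listₚ.map-id (subsets _))))
                   (length-filter-subsets _ P? id)

-- Matchings of paths

matching-tail : ∀ {b} {M : Subset n} →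
  IsMatching (path (suc (suc n))) (b ∷ M) → IsMatching (path (suc n)) M
matching-tail matching e f e∈M f∈M v v-e v-f = Finₚ.suc-injective
  (matching (suc e) (suc f) (there e∈M) (there f∈M) (suc v)
    (Sum.map (cong suc) (cong suc) v-e) (Sum.map (cong suc) (cong suc) v-f))

-- The only new conflicts are between edge 0 and a later edge. If `b` is `false`, the condition on
-- them is vacuous.
matching-∷ : ∀ {b} {M : Subset n} →
  (∀ f v → zero ∈ b ∷ M → f ∈ M → Graph.Endpoint (path (suc (suc n))) v zero →
    Graph.Endpoint (path (suc (suc n))) v (suc f) → ⊥) →
  IsMatching (path (suc n)) M → IsMatching (path (suc (suc n))) (b ∷ M)
matching-∷ apart matching zero zero _ _ _ _ _ = refl
matching-∷ apart matching zero (suc f) 0∈ (there f∈M) v v-0 v-f =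
  ⊥-elim (apart f v 0∈ f∈M v-0 v-f)
matching-∷ apart matching (suc e) zero (there e∈M) 0∈ v v-e v-0 =
  ⊥-elim (apart e v 0∈ e∈M v-0 v-e)
matching-∷ apart matching (suc e) (suc f) (there e∈M) (there f∈M) (suc v) v-e v-f =
  cong suc (matching e f e∈M f∈M v
    (Sum.map Finₚ.suc-injective Finₚ.suc-injective v-e)
    (Sum.map Finₚ.suc-injective Finₚ.suc-injective v-f))
matching-∷ apart matching (suc e) (suc f) _ _ zero (inj₁ ()) _
matching-∷ apart matching (suc e) (suc f) _ _ zero (inj₂ ()) _

matching-false∷ : {M : Subset n} →
  IsMatching (path (suc (suc n))) (false ∷ M) ⇔ IsMatching (path (suc n)) M
matching-false∷ = mk⇔ matching-tail (matching-∷ λ _ _ ())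

matching-true∷false∷ : {M : Subset n} →
  IsMatching (path (suc (suc (suc n)))) (true ∷ false ∷ M) ⇔ IsMatching (path (suc n)) M
matching-true∷false∷ = mk⇔
  (λ matching → matching-tail (matching-tail matching))
  (λ matching → matching-∷ apart (matching-∷ (λ _ _ ()) matching))
  where
  apart : ∀ f v → zero ∈ true ∷ false ∷ _ → f ∈ false ∷ _ → _ → _ → ⊥
  apart (suc f) _ _ _ (inj₁ refl) (inj₁ ())
  apart (suc f) _ _ _ (inj₁ refl) (inj₂ ())
  apart (suc f) _ _ _ (inj₂ refl) (inj₁ ())
  apart (suc f) _ _ _ (inj₂ refl) (inj₂ ())

¬matching-true∷true∷ : {M : Subset n} →
  ¬ IsMatching (path (suc (suc (suc n)))) (true ∷ true ∷ M)
¬matching-true∷true∷ matching with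
  matching zero (suc zero) here (there here) (suc zero) (inj₂ refl) (inj₁ refl)
... | ()

-- Sort the matchings by their first two edges. A chosen first edge forbids the second, and the
-- edges after the second do not touch it.
m-path : ∀ n → m (path (3 + n)) ≡ m (path (2 + n)) + m (path (1 + n))
m-path n = begin
  m (path (3 + n))
    ≡⟨ count≡∑ (isMatching? (path (3 + n))) ⟩
  ∑ (suc n) (λ M → matches (3 + n) (false ∷ M)) +
    (∑ n (λ M → matches (3 + n) (true ∷ false ∷ M)) +
     ∑ n (λ M → matches (3 + n) (true ∷ true ∷ M)))
    ≡⟨ cong₂ _+_
         (∑-cong (suc n) λ M → cong ⟦_⟧
           (does-⇔ matching-false∷ (matching? (3 + n) _) (matching? (2 + n) M)))
         (cong₂ _+_
           (∑-cong n λ M → cong ⟦_⟧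
             (does-⇔ matching-true∷false∷ (matching? (3 + n) _) (matching? (1 + n) M)))
           (trans (∑-cong n λ M → cong ⟦_⟧
                    (dec-false (matching? (3 + n) (true ∷ true ∷ M)) ¬matching-true∷true∷))
                  (∑-zero n))) ⟩
  ∑ (suc n) (matches (2 + n)) + (∑ n (matches (1 + n)) + 0)
    ≡⟨ cong₂ _+_ (sym (count≡∑ (isMatching? (path (2 + n)))))
         (trans (ℕₚ.+-identityʳ _) (sym (count≡∑ (isMatching? (path (1 + n)))))) ⟩
  m (path (2 + n)) + m (path (1 + n)) ∎
  where
  open ≡-Reasoning
  matching? : ∀ k → Decidable (IsMatching (path k))
  matching? k = isMatching? (path k)
  matches : ∀ k → Subset (Graph.size (path k)) → ℕ
  matches k M = ⟦ does (matching? k M) ⟧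

-- Row vectors (x , y) multiplied by powers of the transfer matrix of an
-- unrooted rim vertex.
lo hi : ℕ → ℕ → ℕ → ℕ
lo zero    x y = x
lo (suc d) x y = lo d x y + lo d x y + hi d x y
hi zero    x y = y
hi (suc d) x y = lo d x y + hi d x y

-- The matrix of `lo` and `hi` is the square of the Fibonacci matrix, so one step of it is two steps
-- of `m-path`. Here `hi d 1 1` is the number of matchings of the path on `d + d` vertices; adding
-- `lo d 1 1` moves the even case up to lengths that `m-path` covers.
m-path-odd : ∀ d → m (path (1 + (d + d))) ≡ lo d 1 1
m-path-even : ∀ d → m (path (2 + (d + d))) ≡ lo d 1 1 + hi d 1 1
m-path-odd zero    = refl
m-path-odd (suc d) = begin
  m (path (2 + (d + suc d)))      ≡⟨ cong (λ k → m (path (2 + k))) (ℕₚ.+-suc d d) ⟩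
  m (path (3 + (d + d)))          ≡⟨ m-path (d + d) ⟩
  m (path (2 + (d + d))) + m (path (1 + (d + d)))
    ≡⟨ cong₂ _+_ (m-path-even d) (m-path-odd d) ⟩
  (x + y) + x                     ≡⟨ ring x y ⟩
  (x + x) + y ∎
  where
  open ≡-Reasoning
  x = lo d 1 1
  y = hi d 1 1
  ring : ∀ x y → (x + y) + x ≡ (x + x) + y
  ring = solve-∀
m-path-even zero    = refl
m-path-even (suc d) = begin
  m (path (3 + (d + suc d)))
    ≡⟨ m-path (d + suc d) ⟩
  m (path (1 + (suc d + suc d))) + m (path (1 + (d + suc d)))
    ≡⟨ cong₂ _+_ (m-path-odd (suc d))
         (trans (cong (λ k → m (path (1 + k))) (ℕₚ.+-suc d d)) (m-path-even d)) ⟩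
  lo (suc d) 1 1 + hi (suc d) 1 1 ∎
  where
  open ≡-Reasoning

m-path-interval : ∀ d → m (path (2 * suc d ∸ 1)) ≡ lo d 1 1
m-path-interval d = trans (cong (m ∘ path) (ring d)) (m-path-odd d)
  where
  ring : ∀ d → d + suc (d + 0) ≡ 1 + (d + d)
  ring = solve-∀

-- Transfer matrices

-- The state before a rim vertex says whether its rim component, as far as
-- visited, already contains a root (a vertex of R, or the centre through a
-- spoke).  The letters are: q, membership of the vertex in R; b, presence of its
-- spoke; a, presence of the rim edge to the next vertex.  The result nothing
-- means that a component gets two roots or is closed without one.
step : (q b a s : Bool) → Maybe Bool
step true  false a     false = just a
step false true  a     false = just a
step false false a     true  = just a
step false false true  false = just false
step _     _     _     _     = nothing

run : (Q B A : Subset n) → Bool → Maybe Bool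
run []      []      []      s = just s
run (q ∷ Q) (b ∷ B) (a ∷ A) s = step q b a s >>= run Q B A

hit : Maybe Bool → Bool → ℕ
hit (just true)  true  = 1
hit (just false) false = 1
hit _            _     = 0

-- An entry of the product of the transfer matrices along `Q`. The initial state is a `Maybe` so
-- that the outcome of one `step` can be inserted directly.
∑run : Subset n → Maybe Bool → Bool → ℕ
∑run {n} Q s s′ = ∑ n λ A → ∑ n λ B → hit (s >>= run Q B A) s′

∑run-nothing : ∀ (Q : Subset n) s′ → ∑run Q nothing s′ ≡ 0
∑run-nothing {n} Q s′ = trans (∑-cong n λ _ → ∑-zero n) (∑-zero n)

∑run-∷ : ∀ q (Q : Subset n) s s′ →
  ∑run (q ∷ Q) (just s) s′ ≡
  (∑run Q (step q false false s) s′ + ∑run Q (step q true false s) s′) +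
  (∑run Q (step q false true s) s′ + ∑run Q (step q true true s) s′)
∑run-∷ {n} q Q s s′ = cong₂ _+_ (∑-+ n _ _) (∑-+ n _ _)

-- W Q x y s′ is the s′-entry of the row vector (x , y) times the transfer
-- matrix of Q.
W : Subset n → ℕ → ℕ → Bool → ℕ
W Q x y s′ = x * ∑run Q (just false) s′ + y * ∑run Q (just true) s′

-- From `false`, two letters lead to `false` (spoke or following rim edge alone) and one to `true`
-- (both). From `true`, a spoke fails and the next state is the presence of the rim edge.
W-unrooted : ∀ (Q : Subset n) x y s′ → W (false ∷ Q) x y s′ ≡ W Q (x + x + y) (x + y) s′
W-unrooted Q x y s′
  rewrite ∑run-∷ false Q false s′ | ∑run-∷ false Q true s′ | ∑run-nothing Q s′ =
  ring x y (∑run Q (just false) s′) (∑run Q (just true) s′)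
  where
  ring : ∀ x y u v → x * ((0 + u) + (u + v)) + y * ((u + 0) + (v + 0)) ≡
                     (x + x + y) * u + (x + y) * v
  ring = solve-∀

-- This is the matrix of rank one: only state `false` survives, and it passes to either state in one
-- way, so all that is remembered is a multiple of (1 , 1).
W-rooted : ∀ (Q : Subset n) x y s′ → W (true ∷ Q) x y s′ ≡ W Q x x s′
W-rooted Q x y s′
  rewrite ∑run-∷ true Q false s′ | ∑run-∷ true Q true s′ | ∑run-nothing Q s′ =
  ring x y (∑run Q (just false) s′) (∑run Q (just true) s′)
  where
  ring : ∀ x y u v → x * ((u + 0) + (v + 0)) + y * 0 ≡ x * u + x * v
  ring = solve-∀

W-scale : ∀ (Q : Subset n) c x y s′ → W Q (c * x) (c * y) s′ ≡ c * W Q x y s′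
W-scale Q c x y s′ = ring c x y _ _
  where
  ring : ∀ c x y u v → c * x * u + c * y * v ≡ c * (x * u + y * v)
  ring = solve-∀

lo-+ : ∀ k l x y → lo (k + l) x y ≡ lo k (lo l x y) (hi l x y)
hi-+ : ∀ k l x y → hi (k + l) x y ≡ hi k (lo l x y) (hi l x y)
lo-+ zero    l x y = refl
lo-+ (suc k) l x y rewrite lo-+ k l x y | hi-+ k l x y = refl
hi-+ zero    l x y = refl
hi-+ (suc k) l x y rewrite lo-+ k l x y | hi-+ k l x y = refl

-- Recombines the contributions of the two initial states of a trace into one vector.
lo-linear : ∀ k x y → lo k x y ≡ x * lo k 1 0 + y * lo k 0 1
hi-linear : ∀ k x y → hi k x y ≡ x * hi k 1 0 + y * hi k 0 1
lo-linear zero    x y = ring x y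
  where
  ring : ∀ x y → x ≡ x * 1 + y * 0
  ring = solve-∀
lo-linear (suc k) x y rewrite lo-linear k x y | hi-linear k x y =
  ring x y (lo k 1 0) (lo k 0 1) (hi k 1 0) (hi k 0 1)
  where
  ring : ∀ x y a b c d → x * a + y * b + (x * a + y * b) + (x * c + y * d) ≡
                         x * (a + a + c) + y * (b + b + d)
  ring = solve-∀
hi-linear zero    x y = ring x y
  where
  ring : ∀ x y → y ≡ x * 0 + y * 1
  ring = solve-∀
hi-linear (suc k) x y rewrite lo-linear k x y | hi-linear k x y =
  ring x y (lo k 1 0) (lo k 0 1) (hi k 1 0) (hi k 0 1)
  where
  ring : ∀ x y a b c d → (x * a + y * b) + (x * c + y * d) ≡ x * (a + c) + y * (b + d)
  ring = solve-∀

-- Positions and intervals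

positions : ℕ → Subset n → List ℕ
positions o []          = []
positions o (true ∷ Q)  = o ∷ positions (suc o) Q
positions o (false ∷ Q) = positions (suc o) Q

filter-map-suc : ∀ q (Q : Subset n) is →
  filter (_∈? (q ∷ Q)) (map suc is) ≡ map suc (filter (_∈? Q) is)
filter-map-suc q Q []       = refl
filter-map-suc q Q (i ∷ is) with does (i ∈? Q)
... | true  = cong (suc i ∷_) (filter-map-suc q Q is)
... | false = filter-map-suc q Q is

elements-∷ : ∀ q (Q : Subset n) →
  filter (_∈? (q ∷ Q)) (List.tabulate suc) ≡ map suc (elements Q)
elements-∷ q Q = trans (cong (filter (_∈? (q ∷ Q))) (sym (Listₚ.map-tabulate id suc)))
                       (filter-map-suc q Q (allFin _))

elements≡positions : ∀ o (Q : Subset n) → map ((o +_) ∘ toℕ) (elements Q) ≡ positions o Q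
elements≡positions o [] = refl
elements≡positions o (q ∷ Q) = begin
  map ((o +_) ∘ toℕ) (elements (q ∷ Q)) ≡⟨ head q ⟩
  cons q (map ((o +_) ∘ toℕ) (map suc (elements Q)))
    ≡⟨ cong (cons q) (sym (Listₚ.map-∘ (elements Q))) ⟩
  cons q (map ((o +_) ∘ toℕ ∘ suc) (elements Q))
    ≡⟨ cong (cons q) (Listₚ.map-cong (λ i → ℕₚ.+-suc o (toℕ i)) (elements Q)) ⟩
  cons q (map ((suc o +_) ∘ toℕ) (elements Q))
    ≡⟨ cong (cons q) (elements≡positions (suc o) Q) ⟩
  cons q (positions (suc o) Q) ≡⟨ last q ⟩
  positions o (q ∷ Q) ∎
  where
  open ≡-Reasoning
  cons : Bool → List ℕ → List ℕ
  cons true  xs = o ∷ xs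
  cons false xs = xs
  head : ∀ q → map ((o +_) ∘ toℕ) (elements (q ∷ Q)) ≡
               cons q (map ((o +_) ∘ toℕ) (map suc (elements Q)))
  head true  = cong₂ _∷_ (ℕₚ.+-identityʳ o) (cong (map _) (elements-∷ true Q))
  head false = cong (map _) (elements-∷ false Q)
  last : ∀ q → cons q (positions (suc o) Q) ≡ positions o (q ∷ Q)
  last true  = refl
  last false = refl

-- `e` is the first root advanced by one full turn, the end of the last interval.
arcs : ℕ → ℕ → List ℕ → List ℕ
arcs e a []       = e ∸ a ∷ []
arcs e a (b ∷ bs) = b ∸ a ∷ arcs e b bs

-- The local function of intervals has no name outside Defs, and its hidden
-- parameters include the whole tail.  Abstracting that tail separates it from
-- the arguments, so that unification can recover the function.
mutual
  intervals-go : ℕ → ℕ → List ℕ → ℕ → List ℕ → List ℕ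
  intervals-go = _

  intervals≡arcs : ∀ N a as → intervals N (a ∷ as) ≡ arcs (a + N) a as
  intervals≡arcs N a []       = refl
  intervals≡arcs N a (b ∷ bs) with cs ← b ∷ bs =
    cong (b ∸ a ∷_) (intervals-go≡arcs N a cs b bs)

  intervals-go≡arcs : ∀ N a cs b bs → intervals-go N a cs b bs ≡ arcs (a + N) b bs
  intervals-go≡arcs N a cs b []       = refl
  intervals-go≡arcs N a cs b (c ∷ bs) =
    cong (c ∸ b ∷_) (intervals-go≡arcs N a cs c bs)

weight : ℕ → ℕ
weight d = m (path (2 * d ∸ 1))

-- The trace of the transfer matrix, closed up by the k unrooted vertices that
-- precede the first root; l unrooted vertices follow the last root a seen so
-- far, and c is the product of the completed intervals.
trace-arcs : ∀ (Q : Subset n) a l c k → let o = suc (l + a) in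
  lo k 1 0 * W Q (c * lo l 1 1) (c * hi l 1 1) false +
  lo k 0 1 * W Q (c * lo l 1 1) (c * hi l 1 1) true
  ≡ c * product (map weight (arcs (o + n + k) a (positions o Q)))
trace-arcs [] a l c k = begin
  p * (c * x * 1 + c * y * 0) + q * (c * x * 0 + c * y * 1)
    ≡⟨ ring p q c x y ⟩
  c * (x * p + y * q)
    ≡⟨ cong (c *_) (sym (lo-linear k x y)) ⟩
  c * lo k x y
    -- The `l` vertices after the last root and the `k` before the first form one gap, so the last
    -- interval has length `suc (k + l)`.
    ≡⟨ cong (c *_) (sym (lo-+ k l 1 1)) ⟩
  c * lo (k + l) 1 1
    ≡⟨ cong (c *_) (sym (m-path-interval (k + l))) ⟩
  c * weight (suc (k + l))
    ≡⟨ cong (λ d → c * weight d)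
         (sym (trans (cong (_∸ a) (ring′ k l a)) (ℕₚ.m+n∸n≡m (suc (k + l)) a))) ⟩
  c * weight (suc (l + a) + 0 + k ∸ a)
    ≡⟨ cong (c *_) (sym (ℕₚ.*-identityʳ _)) ⟩
  c * (weight (suc (l + a) + 0 + k ∸ a) * 1) ∎
  where
  open ≡-Reasoning
  p = lo k 1 0
  q = lo k 0 1
  x = lo l 1 1
  y = hi l 1 1
  ring : ∀ p q c x y →
    p * (c * x * 1 + c * y * 0) + q * (c * x * 0 + c * y * 1) ≡ c * (x * p + y * q)
  ring = solve-∀
  ring′ : ∀ k l a → suc (l + a) + 0 + k ≡ suc (k + l) + a
  ring′ = solve-∀
trace-arcs {suc n} (false ∷ Q) a l c k = begin
  _ ≡⟨ cong₂ (λ u v → lo k 1 0 * u + lo k 0 1 * v) (advance false) (advance true) ⟩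
  _ ≡⟨ trace-arcs Q a (suc l) c k ⟩
  c * product (map weight (arcs (suc (suc (l + a)) + n + k) a (positions (suc (suc (l + a))) Q)))
    ≡⟨ cong (λ e → c * product (map weight (arcs (e + k) a (positions (suc (suc (l + a))) Q))))
         (sym (ℕₚ.+-suc (suc (l + a)) n)) ⟩
  _ ∎
  where
  open ≡-Reasoning
  ring : ∀ c x y → c * x + c * x + c * y ≡ c * (x + x + y)
  ring = solve-∀
  advance : ∀ s′ → W (false ∷ Q) (c * lo l 1 1) (c * hi l 1 1) s′ ≡
                   W Q (c * lo (suc l) 1 1) (c * hi (suc l) 1 1) s′
  advance s′ = trans (W-unrooted Q (c * lo l 1 1) (c * hi l 1 1) s′)
    (cong₂ (λ x y → W Q x y s′) (ring c (lo l 1 1) _) (sym (ℕₚ.*-distribˡ-+ c (lo l 1 1) _)))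
trace-arcs {suc n} (true ∷ Q) a l c k = begin
  _ ≡⟨ cong₂ (λ u v → lo k 1 0 * u + lo k 0 1 * v) (restart false) (restart true) ⟩
  -- The root at `o` completes an interval of length `suc l`, whose weight `lo l 1 1` passes into
  -- `c`; the count restarts at `l = 0`.
  _ ≡⟨ trace-arcs Q (suc (l + a)) 0 (c * lo l 1 1) k ⟩
  c * lo l 1 1 * rest (suc o + n + k)
    ≡⟨ ℕₚ.*-assoc c (lo l 1 1) _ ⟩
  c * (lo l 1 1 * rest (suc o + n + k))
    ≡⟨ cong₂ (λ u v → c * (u * rest (v + k)))
         (trans (sym (m-path-interval l)) (cong weight (sym (ℕₚ.m+n∸n≡m (suc l) a))))
         (sym (ℕₚ.+-suc o n)) ⟩
  _ ∎
  where
  open ≡-Reasoning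
  o = suc (l + a)
  rest : ℕ → ℕ
  rest e = product (map weight (arcs e o (positions (suc o) Q)))
  restart : ∀ s′ → W (true ∷ Q) (c * lo l 1 1) (c * hi l 1 1) s′ ≡
                   W Q (c * lo l 1 1 * 1) (c * lo l 1 1 * 1) s′
  restart s′ = trans (W-rooted Q (c * lo l 1 1) (c * hi l 1 1) s′)
    (cong (λ x → W Q x x s′) (sym (ℕₚ.*-identityʳ (c * lo l 1 1))))

-- Each diagonal entry is carried along as a row vector started at a basis vector, after `k`
-- unrooted vertices. At the first root both rows become multiples of (1 , 1), and `trace-arcs`
-- takes over.
trace-positions : ∀ (Q : Subset n) k {i} → i ∈ Q →
  W Q (lo k 1 0) (hi k 1 0) false + W Q (lo k 0 1) (hi k 0 1) true ≡
  product (map weight (intervals (k + n) (positions (suc k) Q)))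
trace-positions {suc n} (false ∷ Q) k (there i∈Q) = begin
  _ ≡⟨ cong₂ _+_ (W-unrooted Q (lo k 1 0) (hi k 1 0) false) (W-unrooted Q (lo k 0 1) (hi k 0 1) true) ⟩
  _ ≡⟨ trace-positions Q (suc k) i∈Q ⟩
  product (map weight (intervals (suc k + n) (positions (suc (suc k)) Q)))
    ≡⟨ cong (λ N → product (map weight (intervals N (positions (suc (suc k)) Q))))
         (sym (ℕₚ.+-suc k n)) ⟩
  _ ∎
  where open ≡-Reasoning
trace-positions {suc n} (true ∷ Q) k _ = begin
  _ ≡⟨ cong₂ _+_ (factor (lo k 1 0) (hi k 1 0) false) (factor (lo k 0 1) (hi k 0 1) true) ⟩
  lo k 1 0 * W Q 1 1 false + lo k 0 1 * W Q 1 1 true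
    -- The rim is numbered from 1, so the first root has number `suc k`; no interval is complete
    -- yet, hence `c = 1`.
    ≡⟨ trace-arcs Q (suc k) 0 1 k ⟩
  1 * product (map weight (arcs (suc (suc k) + n + k) (suc k) (positions (suc (suc k)) Q)))
    ≡⟨ ℕₚ.*-identityˡ _ ⟩
  product (map weight (arcs (suc (suc k) + n + k) (suc k) (positions (suc (suc k)) Q)))
    ≡⟨ cong (product ∘ map weight) (trans
         (cong (λ e → arcs e (suc k) (positions (suc (suc k)) Q)) (ring k n))
         (sym (intervals≡arcs (k + suc n) (suc k) _))) ⟩
  _ ∎
  where
  open ≡-Reasoning
  ring : ∀ k n → suc (suc k) + n + k ≡ suc k + (k + suc n)
  ring = solve-∀
  factor : ∀ x y s′ → W (true ∷ Q) x y s′ ≡ x * W Q 1 1 s′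
  factor x y s′ = trans (W-rooted Q x y s′)
    (trans (cong (λ z → W Q z z s′) (sym (ℕₚ.*-identityʳ x))) (W-scale Q x 1 1 s′))

trace≡product : ∀ (Q : Subset n) {i} → i ∈ Q →
  ∑run Q (just false) false + ∑run Q (just true) true ≡
  product (map weight (cyclicIntervals (outside ∷ Q)))
trace≡product {n} Q i∈Q = begin
  _ ≡⟨ ring (∑run Q (just false) false) (∑run Q (just true) false)
            (∑run Q (just false) true) (∑run Q (just true) true) ⟩
  _ ≡⟨ trace-positions Q 0 i∈Q ⟩
  product (map weight (intervals n (positions 1 Q)))
    ≡⟨ cong (product ∘ map weight ∘ intervals n) (sym (elements≡positions 0 (outside ∷ Q))) ⟩
  _ ∎
  where
  open ≡-Reasoning
  ring : ∀ a b c d → a + d ≡ (1 * a + 0 * b) + (0 * c + 1 * d)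
  ring = solve-∀
-- The cyclic successor

next≡ : {i : Fin n} {j : Fin n} → toℕ j ≡ suc (toℕ i) → next i ≡ j
next≡ {i = i} {j} j≡1+i with next-cases i
... | inj₁ p       = Finₚ.toℕ-injective (trans p (sym j≡1+i))
... | inj₂ (_ , p) = contradiction (trans j≡1+i p) (ℕₚ.<⇒≢ (Finₚ.toℕ<n j))

next-injective : {i j : Fin n} → next i ≡ next j → i ≡ j
next-injective {i = i} {j} eq with next-cases i | next-cases j
... | inj₁ p       | inj₁ q       =
  Finₚ.toℕ-injective (ℕₚ.suc-injective (trans (sym p) (trans (cong toℕ eq) q)))
... | inj₁ p       | inj₂ (q , _) = contradiction (trans (sym p) (trans (cong toℕ eq) q)) λ ()
... | inj₂ (p , _) | inj₁ q       = contradiction (trans (sym q) (trans (cong toℕ (sym eq)) p)) λ ()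
... | inj₂ (_ , p) | inj₂ (_ , q) = Finₚ.toℕ-injective (ℕₚ.suc-injective (trans p (sym q)))

next-surjective : (i : Fin n) → ∃[ j ] next j ≡ i
next-surjective {suc n} zero with next-cases (fromℕ n)
... | inj₁ p       = contradiction
  (trans p (cong suc (Finₚ.toℕ-fromℕ n))) (ℕₚ.<⇒≢ (Finₚ.toℕ<n (next (fromℕ n))))
... | inj₂ (p , _) = fromℕ n , Finₚ.toℕ-injective p
next-surjective {suc n} (suc i) = inject₁ i , next≡ (cong suc (sym (Finₚ.toℕ-inject₁ i)))

-- Forests from parent relations

argmax : (h : Fin (suc n) → ℕ) → ∃[ i ] ∀ j → h j ≤ h i
argmax {zero}  h = zero , λ { zero → ℕₚ.≤-refl }
argmax {suc n} h with i , max ← argmax (h ∘ suc) with ℕₚ.≤-total (h zero) (h (suc i))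
... | inj₁ h0≤ = suc i , λ { zero → h0≤ ; (suc j) → max j }
... | inj₂ ≤h0 = zero , λ { zero → ℕₚ.≤-refl ; (suc j) → ℕₚ.≤-trans (max j) ≤h0 }

module _ (G : Graph) (S : Subset (Graph.order G)) (F : Subset (Graph.size G))
  (Parent : Graph.Vertex G → Graph.Vertex G → Set) (height : Graph.Vertex G → ℕ)
  (adjacent⇒parent : ∀ {u v} → Adjacent G F u v → Parent u v ⊎ Parent v u)
  (parent⇒adjacent : ∀ {u v} → Parent u v → Adjacent G F u v)
  (functional : ∀ {u v w} → Parent u v → Parent u w → v ≡ w)
  (descending : ∀ {u v} → Parent u v → height v < height u)
  (root⇒¬parent : ∀ {u v} → u ∈ S → ¬ Parent u v)
  (root⊎parent : ∀ u → u ∈ S ⊎ ∃ (Parent u))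
  where

  -- Both neighbours of a highest vertex of a cycle are its parent.
  parents⇒acyclic : Acyclic G F
  parents⇒acyclic (suc k , x , 3≤k , x-injective , adjacent)
    with j , max ← argmax (height ∘ lookup x)
    with i , refl ← next-surjective j =
      next²≢ 3≤k i (sym (x-injective (functional to-prev to-next)))
    where
    to-prev : Parent (lookup x (next i)) (lookup x i)
    to-prev with adjacent⇒parent (adjacent i)
    ... | inj₁ p = contradiction (descending p) (ℕₚ.≤⇒≯ (max i))
    ... | inj₂ p = p
    to-next : Parent (lookup x (next i)) (lookup x (next (next i)))
    to-next with adjacent⇒parent (adjacent (next i))
    ... | inj₁ p = p
    ... | inj₂ p = contradiction (descending p) (ℕₚ.≤⇒≯ (max (next (next i))))

  ancestor : ∀ v → Acc _<_ (height v) → ∃[ s ] s ∈ S × Star Parent v s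
  ancestor v (acc rs) with root⊎parent v
  ... | inj₁ v∈S     = v , v∈S , ε
  ... | inj₂ (u , p) with s , s∈S , ps ← ancestor u (rs (descending p)) = s , s∈S , p ◅ ps

  ancestor-unique : ∀ {v s t} → s ∈ S → t ∈ S → Star Parent v s → Star Parent v t → s ≡ t
  ancestor-unique s∈S t∈S ε        ε        = refl
  ancestor-unique s∈S t∈S ε        (p ◅ ps) = contradiction p (root⇒¬parent s∈S)
  ancestor-unique s∈S t∈S (p ◅ ps) ε        = contradiction p (root⇒¬parent t∈S)
  ancestor-unique s∈S t∈S (p ◅ ps) (q ◅ qs) with refl ← functional p q =
    ancestor-unique s∈S t∈S ps qs

  -- A step from a parent down to a child is cancelled by the first step of the child's chain, which
  -- by functionality leads back to that parent.
  connected⇒ancestor : ∀ {v s} → s ∈ S → Connected G F v s → Star Parent v s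
  connected⇒ancestor s∈S ε       = ε
  connected⇒ancestor s∈S (e ◅ c) with adjacent⇒parent e | connected⇒ancestor s∈S c
  ... | inj₁ p | ps     = p ◅ ps
  ... | inj₂ p | ε      = contradiction p (root⇒¬parent s∈S)
  ... | inj₂ p | q ◅ qs with refl ← functional p q = qs

  parents⇒rootedForest : IsRootedForest G S F
  parents⇒rootedForest = parents⇒acyclic , λ v →
    let s , s∈S , ps = ancestor v (<-wellFounded _) in
    s , (s∈S , Star.map parent⇒adjacent ps) ,
    λ { (t∈S , c) → ancestor-unique s∈S t∈S ps (connected⇒ancestor t∈S c) }

-- Walking round the rim

module Walk {n : ℕ} (a : Fin (suc n)) where
  private
    N : ℕ
    N = suc n

  walk : ℕ → Fin N
  walk zero    = a
  walk (suc k) = next (walk k)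

  -- The inverse of `walk` on numbers below `N`. Adding `N ∸ toℕ a` replaces a subtraction of
  -- `toℕ a` that would be truncated.
  position : Fin N → ℕ
  position i = (toℕ i + (N ∸ toℕ a)) % N

  position<N : ∀ i → position i < N
  position<N i = m%n<n (toℕ i + (N ∸ toℕ a)) N

  %-absorb : ∀ x y → (x % N + y) % N ≡ (x + y) % N
  %-absorb x y = begin
    (x % N + y) % N          ≡⟨ %-distribˡ-+ (x % N) y N ⟩
    (x % N % N + y % N) % N  ≡⟨ cong (λ z → (z + y % N) % N) (m%n%n≡m%n x N) ⟩
    (x % N + y % N) % N      ≡⟨ sym (%-distribˡ-+ x y N) ⟩
    (x + y) % N              ∎
    where open ≡-Reasoning

  toℕ-next : (i : Fin N) → toℕ (next i) ≡ suc (toℕ i) % N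
  toℕ-next i = Finₚ.toℕ-fromℕ< (m%n<n (suc (toℕ i)) N)

  toℕ-walk : ∀ k → toℕ (walk k) ≡ (k + toℕ a) % N
  toℕ-walk zero    = sym (m<n⇒m%n≡m (Finₚ.toℕ<n a))
  toℕ-walk (suc k) = begin
    toℕ (next (walk k))         ≡⟨ toℕ-next (walk k) ⟩
    suc (toℕ (walk k)) % N      ≡⟨ cong (λ x → suc x % N) (toℕ-walk k) ⟩
    suc ((k + toℕ a) % N) % N   ≡⟨ cong (_% N) (ℕₚ.+-comm 1 ((k + toℕ a) % N)) ⟩
    ((k + toℕ a) % N + 1) % N   ≡⟨ %-absorb (k + toℕ a) 1 ⟩
    (k + toℕ a + 1) % N         ≡⟨ cong (_% N) (ℕₚ.+-comm (k + toℕ a) 1) ⟩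
    (suc k + toℕ a) % N         ∎
    where open ≡-Reasoning

  complement : toℕ a + (N ∸ toℕ a) ≡ N
  complement = ℕₚ.m+[n∸m]≡n (ℕₚ.<⇒≤ (Finₚ.toℕ<n a))

  walk-position : ∀ i → walk (position i) ≡ i
  walk-position i = Finₚ.toℕ-injective (begin
    toℕ (walk (position i))                  ≡⟨ toℕ-walk (position i) ⟩
    (position i + toℕ a) % N                 ≡⟨ %-absorb (toℕ i + (N ∸ toℕ a)) (toℕ a) ⟩
    (toℕ i + (N ∸ toℕ a) + toℕ a) % N        ≡⟨ cong (_% N) (ring (toℕ i) _ (toℕ a)) ⟩
    (toℕ i + (toℕ a + (N ∸ toℕ a))) % N      ≡⟨ cong (λ x → (toℕ i + x) % N) complement ⟩
    (toℕ i + N) % N                          ≡⟨ [m+n]%n≡m%n (toℕ i) N ⟩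
    toℕ i % N                                ≡⟨ m<n⇒m%n≡m (Finₚ.toℕ<n i) ⟩
    toℕ i                                    ∎)
    where
    open ≡-Reasoning
    ring : ∀ x y z → x + y + z ≡ x + (z + y)
    ring = solve-∀

  position-walk : ∀ {k} → k < N → position (walk k) ≡ k
  position-walk {k} k<N = begin
    (toℕ (walk k) + (N ∸ toℕ a)) % N         ≡⟨ cong (λ x → (x + (N ∸ toℕ a)) % N) (toℕ-walk k) ⟩
    ((k + toℕ a) % N + (N ∸ toℕ a)) % N      ≡⟨ %-absorb (k + toℕ a) (N ∸ toℕ a) ⟩
    (k + toℕ a + (N ∸ toℕ a)) % N            ≡⟨ cong (_% N) (ℕₚ.+-assoc k (toℕ a) _) ⟩
    (k + (toℕ a + (N ∸ toℕ a))) % N          ≡⟨ cong (λ x → (k + x) % N) complement ⟩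
    (k + N) % N                              ≡⟨ [m+n]%n≡m%n k N ⟩
    k % N                                    ≡⟨ m<n⇒m%n≡m k<N ⟩
    k                                        ∎
    where open ≡-Reasoning

  walk-N : walk N ≡ a
  walk-N = Finₚ.toℕ-injective (begin
    toℕ (walk N)       ≡⟨ toℕ-walk N ⟩
    (N + toℕ a) % N    ≡⟨ cong (_% N) (ℕₚ.+-comm N (toℕ a)) ⟩
    (toℕ a + N) % N    ≡⟨ [m+n]%n≡m%n (toℕ a) N ⟩
    toℕ a % N          ≡⟨ m<n⇒m%n≡m (Finₚ.toℕ<n a) ⟩
    toℕ a              ∎)
    where open ≡-Reasoning

  walk-injective : ∀ {j k} → j < N → k < N → walk j ≡ walk k → j ≡ k
  walk-injective j<N k<N eq =
    trans (sym (position-walk j<N)) (trans (cong position eq) (position-walk k<N))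

  -- The hypothesis excludes the single step at which the position drops back to 0.
  position-next : ∀ i → next i ≢ a → position (next i) ≡ suc (position i)
  position-next i next≢a with ℕₚ.m≤n⇒m<n∨m≡n (position<N i)
  ... | inj₁ <N = trans (cong (position ∘ next) (sym (walk-position i))) (position-walk <N)
  ... | inj₂ ≡N = contradiction
    (trans (cong next (sym (walk-position i))) (trans (cong walk ≡N) walk-N)) next≢a

-- Rooted forests of the wheel

-- The successful steps, named by how the vertex reaches its root. Equations replace indices because
-- the letters will be lookups, which do not unify with constants.
data Transition (q b a s s′ : Bool) : Set where
  rooted    : q ≡ true → b ≡ false → s ≡ false → s′ ≡ a → Transition q b a s s′
  spoked    : q ≡ false → b ≡ true → s ≡ false → s′ ≡ a → Transition q b a s s′
  leftward  : q ≡ false → b ≡ false → s ≡ true → s′ ≡ a → Transition q b a s s′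
  rightward : q ≡ false → b ≡ false → s ≡ false → a ≡ true → s′ ≡ false →
              Transition q b a s s′

transition : ∀ q b a s {s′} → step q b a s ≡ just s′ → Transition q b a s s′
transition true  false a     false refl = rooted refl refl refl refl
transition false true  a     false refl = spoked refl refl refl refl
transition false false a     true  refl = leftward refl refl refl refl
transition false false true  false refl = rightward refl refl refl refl refl
transition false false false false ()
transition true  false a     true  ()
transition false true  a     true  ()
transition true  true  a     false ()
transition true  true  a     true  ()

true≢false : ∀ {x} → x ≡ true → x ≡ false → ⊥
true≢false refl ()

module Wheel {n : ℕ} (3≤N : 3 ≤ suc n) (Q B A : Subset (suc n))
             (a : Fin (suc n)) (a∈Q : lookup Q a ≡ true) where
  open Walk a

  private
    N : ℕ
    N = suc n

    G : Graph
    G = wheel N 3≤N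

    S : Subset (suc N)
    S = inside ∷ Q

    F : Subset (N + N)
    F = A ++ B

  -- The edges of `F` as listed, with `splitAt` already resolved, so that proofs can match on rim
  -- edge or spoke.
  data Link : Fin (suc N) → Fin (suc N) → Set where
    rim   : ∀ i → lookup A i ≡ true → Link (suc i) (suc (next i))
    spoke : ∀ i → lookup B i ≡ true → Link centre (suc i)

  Adj : Fin (suc N) → Fin (suc N) → Set
  Adj u v = Link u v ⊎ Link v u

  link : ∀ {u v} e → e ∈ F → wheelEnds N e ≡ (u , v) → Link u v
  link e e∈F ends≡ with p ← trans (sym (Vecₚ.lookup-splitAt N A B e)) (Vecₚ.[]=⇒lookup e∈F)
    with splitAt N e
  ... | inj₁ i with refl ← ends≡ = rim i p
  ... | inj₂ i with refl ← ends≡ = spoke i p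

  adjacent⇒adj : ∀ {u v} → Adjacent G F u v → Adj u v
  adjacent⇒adj (e , e∈F , inj₁ p) = inj₁ (link e e∈F p)
  adjacent⇒adj (e , e∈F , inj₂ p) = inj₂ (link e e∈F p)

  edge : ∀ {u v} → Link u v → ∃[ e ] e ∈ F × wheelEnds N e ≡ (u , v)
  edge (rim i i∈A) = i ↑ˡ N , Vecₚ.lookup⇒[]= _ F (trans (Vecₚ.lookup-++ˡ A B i) i∈A) , ends
    where
    ends : wheelEnds N (i ↑ˡ N) ≡ (suc i , suc (next i))
    ends rewrite Finₚ.splitAt-↑ˡ N i N = refl
  edge (spoke i i∈B) = N ↑ʳ i , Vecₚ.lookup⇒[]= _ F (trans (Vecₚ.lookup-++ʳ A B i) i∈B) , ends
    where
    ends : wheelEnds N (N ↑ʳ i) ≡ (centre , suc i)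
    ends rewrite Finₚ.splitAt-↑ʳ N N i = refl

  adj⇒adjacent : ∀ {u v} → Adj u v → Adjacent G F u v
  adj⇒adjacent (inj₁ l) with e , e∈F , p ← edge l = e , e∈F , inj₁ p
  adj⇒adjacent (inj₂ l) with e , e∈F , p ← edge l = e , e∈F , inj₂ p

  -- t i says that the path from rim vertex i to its root starts with the rim
  -- edge to the preceding vertex.
  module FromStates (t : Fin N → Bool)
    (steps : ∀ i → step (lookup Q i) (lookup B i) (lookup A i) (t i) ≡ just (t (next i)))
    where

    transitions : ∀ i → Transition (lookup Q i) (lookup B i) (lookup A i) (t i) (t (next i))
    transitions i = transition _ _ _ _ (steps i)

    -- The equation `j ≡ next i` is an argument since `next i` in an index would obstruct matching.
    data Parent : Fin (suc N) → Fin (suc N) → Set where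
      to-centre : ∀ i → lookup B i ≡ true → Parent (suc i) centre
      to-left   : ∀ i {j} → j ≡ next i → t j ≡ true → Parent (suc j) (suc i)
      to-right  : ∀ i {j} → j ≡ next i → lookup Q i ≡ false → lookup B i ≡ false →
                  t i ≡ false → Parent (suc i) (suc j)

    -- Leftward paths lower the position and rightward paths raise it. Positions are counted from a
    -- vertex `a` of R, where every path stops at height 0, so no path continues across the jump in
    -- position.
    height-rim : (q b t : Bool) → ℕ → ℕ
    height-rim true  _     _     p = 0
    height-rim false true  _     p = 1
    height-rim false false true  p = suc p
    height-rim false false false p = suc (N ∸ p)

    height : Fin (suc N) → ℕ
    height zero    = 0
    height (suc i) = height-rim (lookup Q i) (lookup B i) (t i) (position i)

    left⇒plain : ∀ i → t i ≡ true → lookup Q i ≡ false × lookup B i ≡ false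
    left⇒plain i ti with transitions i
    ... | rooted _ _ ti′ _      = ⊥-elim (true≢false ti ti′)
    ... | spoked _ _ ti′ _      = ⊥-elim (true≢false ti ti′)
    ... | leftward q b _ _      = q , b
    ... | rightward _ _ ti′ _ _ = ⊥-elim (true≢false ti ti′)

    spoke⇒plain : ∀ i → lookup B i ≡ true → lookup Q i ≡ false × t i ≡ false
    spoke⇒plain i bi with transitions i
    ... | rooted _ bi′ _ _      = ⊥-elim (true≢false bi bi′)
    ... | spoked q _ ti _       = q , ti
    ... | leftward _ bi′ _ _    = ⊥-elim (true≢false bi bi′)
    ... | rightward _ bi′ _ _ _ = ⊥-elim (true≢false bi bi′)

    rim-parent : ∀ i → lookup A i ≡ true →
                 Parent (suc i) (suc (next i)) ⊎ Parent (suc (next i)) (suc i)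
    rim-parent i i∈A with transitions i
    ... | rooted _ _ _ t≡a         = inj₂ (to-left i refl (trans t≡a i∈A))
    ... | spoked _ _ _ t≡a         = inj₂ (to-left i refl (trans t≡a i∈A))
    ... | leftward _ _ _ t≡a       = inj₂ (to-left i refl (trans t≡a i∈A))
    ... | rightward qi bi ti _ _   = inj₁ (to-right i refl qi bi ti)

    adjacent⇒parent : ∀ {u v} → Adjacent G F u v → Parent u v ⊎ Parent v u
    adjacent⇒parent e with adjacent⇒adj e
    ... | inj₁ (rim i i∈A)   = rim-parent i i∈A
    ... | inj₁ (spoke i i∈B) = inj₂ (to-centre i i∈B)
    ... | inj₂ (rim i i∈A)   = Sum.swap (rim-parent i i∈A)
    ... | inj₂ (spoke i i∈B) = inj₁ (to-centre i i∈B)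

    parent⇒adj : ∀ {u v} → Parent u v → Adj u v
    parent⇒adj (to-centre i i∈B) = inj₂ (spoke i i∈B)
    parent⇒adj (to-left i refl t≡true) with transitions i
    ... | rooted _ _ _ t≡a          = inj₂ (rim i (trans (sym t≡a) t≡true))
    ... | spoked _ _ _ t≡a          = inj₂ (rim i (trans (sym t≡a) t≡true))
    ... | leftward _ _ _ t≡a        = inj₂ (rim i (trans (sym t≡a) t≡true))
    ... | rightward _ _ _ _ t≡false = ⊥-elim (true≢false t≡true t≡false)
    parent⇒adj (to-right i refl qi bi ti) with transitions i
    ... | rooted qi′ _ _ _      = ⊥-elim (true≢false qi′ qi)
    ... | spoked _ bi′ _ _      = ⊥-elim (true≢false bi′ bi)
    ... | leftward _ _ ti′ _    = ⊥-elim (true≢false ti′ ti)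
    ... | rightward _ _ _ i∈A _ = inj₁ (rim i i∈A)

    functional : ∀ {u v w} → Parent u v → Parent u w → v ≡ w
    functional (to-centre i bi) (to-centre _ _)       = refl
    functional (to-centre i bi) (to-left _ _ ti)      = ⊥-elim (true≢false ti (proj₂ (spoke⇒plain i bi)))
    functional (to-centre i bi) (to-right _ _ _ bi′ _) = ⊥-elim (true≢false bi bi′)
    functional (to-left _ _ ti) (to-centre i bi)      = ⊥-elim (true≢false ti (proj₂ (spoke⇒plain i bi)))
    functional (to-left i p _) (to-left j q _)        = cong suc (next-injective (trans (sym p) q))
    functional (to-left _ _ ti) (to-right _ _ _ _ ti′) = ⊥-elim (true≢false ti ti′)
    functional (to-right _ _ _ bi′ _) (to-centre i bi) = ⊥-elim (true≢false bi bi′)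
    functional (to-right _ _ _ _ ti′) (to-left _ _ ti) = ⊥-elim (true≢false ti ti′)
    functional (to-right _ p _ _ _) (to-right _ q _ _ _) = cong suc (trans p (sym q))

    root⇒¬parent : ∀ {u v} → u ∈ S → ¬ Parent u v
    root⇒¬parent (there i∈Q) (to-centre i bi) =
      true≢false (Vecₚ.[]=⇒lookup i∈Q) (proj₁ (spoke⇒plain i bi))
    root⇒¬parent (there i∈Q) (to-left _ _ ti) =
      true≢false (Vecₚ.[]=⇒lookup i∈Q) (proj₁ (left⇒plain _ ti))
    root⇒¬parent (there i∈Q) (to-right _ _ qi _ _) =
      true≢false (Vecₚ.[]=⇒lookup i∈Q) qi

    root⊎parent : ∀ u → u ∈ S ⊎ ∃ (Parent u)
    root⊎parent zero    = inj₁ here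
    root⊎parent (suc i) with transitions i
    ... | rooted qi _ _ _       = inj₁ (there (Vecₚ.lookup⇒[]= i Q qi))
    ... | spoked _ bi _ _       = inj₂ (_ , to-centre i bi)
    ... | leftward _ _ ti _     with j , p ← next-surjective i = inj₂ (_ , to-left j (sym p) ti)
    ... | rightward qi bi ti _ _ = inj₂ (_ , to-right i refl qi bi ti)

    unrooted⇒≢a : ∀ {i} → lookup Q i ≡ false → i ≢ a
    unrooted⇒≢a qi refl = true≢false a∈Q qi

    descending : ∀ {u v} → Parent u v → height v < height u
    descending (to-centre i bi) rewrite proj₁ (spoke⇒plain i bi) | bi = s≤s z≤n
    descending (to-left i refl t≡true)
      with qj , bj ← left⇒plain (next i) t≡true
      rewrite qj | bj | t≡true | position-next i (unrooted⇒≢a qj) with transitions i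
    ... | rooted qi _ _ _      rewrite qi           = s≤s z≤n
    ... | spoked qi bi _ _     rewrite qi | bi      = s≤s (s≤s z≤n)
    ... | leftward qi bi ti _  rewrite qi | bi | ti = ℕₚ.≤-refl
    ... | rightward _ _ _ _ t≡false = ⊥-elim (true≢false t≡true t≡false)
    descending (to-right i refl qi bi ti)
      rewrite qi | bi | ti with transitions (next i) | transitions i
    ... | rooted qj _ _ _        | _ rewrite qj = s≤s z≤n
    ... | spoked qj bj _ _       | _ rewrite qj | bj = s≤s (ℕₚ.m<n⇒0<n∸m (position<N i))
    -- Two neighbours cannot point at each other: an unmarked vertex in state `false` hands on
    -- `false`.
    ... | leftward _ _ tj _      | rooted qi′ _ _ _      = ⊥-elim (true≢false qi′ qi)
    ... | leftward _ _ tj _      | spoked _ bi′ _ _      = ⊥-elim (true≢false bi′ bi)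
    ... | leftward _ _ tj _      | leftward _ _ ti′ _    = ⊥-elim (true≢false ti′ ti)
    ... | leftward _ _ tj _      | rightward _ _ _ _ tj′ = ⊥-elim (true≢false tj tj′)
    ... | rightward qj bj tj _ _ | _
      rewrite qj | bj | tj | position-next i (unrooted⇒≢a qj) =
      s≤s (ℕₚ.∸-monoʳ-< (ℕₚ.n<1+n (position i)) (position<N i))

    rootedForest : IsRootedForest G S F
    rootedForest = parents⇒rootedForest G S F Parent height adjacent⇒parent
      (adj⇒adjacent ∘ parent⇒adj) functional descending root⇒¬parent root⊎parent

  -- From a rooted forest to the states along the walk

  module FromForest (forest : IsRootedForest G S F) where

    private
      Path : Fin (suc N) → Fin (suc N) → Set
      Path = Star Adj

      q b e : ℕ → Bool
      q k = lookup Q (walk k)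
      b k = lookup B (walk k)
      e k = lookup A (walk k)

    root : ∀ v → ∃[ s ] s ∈ S × Path v s
    root v with s , (s∈S , c) , _ ← proj₂ forest v = s , s∈S , Star.map adjacent⇒adj c

    roots-equal : ∀ {v s t} → s ∈ S → t ∈ S → Path v s → Path v t → s ≡ t
    roots-equal {v} s∈S t∈S ps pt with _ , _ , unique ← proj₂ forest v =
      trans (sym (unique (s∈S , Star.map adj⇒adjacent ps))) (unique (t∈S , Star.map adj⇒adjacent pt))

    no-cycle : 3 ≤ k → (x : Fin k → Fin (suc N)) → Injective _≡_ _≡_ x →
               (∀ i → Adj (x i) (x (next i))) → ⊥
    no-cycle 3≤k x x-injective adj = proj₁ forest (_ , tabulate x , 3≤k , injective , adjacent)
      where
      injective : Injective _≡_ _≡_ (lookup (tabulate x))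
      injective {i} {j} eq = x-injective
        (trans (sym (Vecₚ.lookup∘tabulate x i)) (trans eq (Vecₚ.lookup∘tabulate x j)))
      adjacent : ∀ i → Adjacent G F (lookup (tabulate x) i) (lookup (tabulate x) (next i))
      adjacent i = subst₂ (Adjacent G F) (sym (Vecₚ.lookup∘tabulate x i))
        (sym (Vecₚ.lookup∘tabulate x (next i))) (adj⇒adjacent (adj i))

    Marked : Fin N → Set
    Marked i = lookup Q i ≡ true ⊎ lookup B i ≡ true

    root-and-spoke : ∀ i → lookup Q i ≡ true → lookup B i ≡ true → ⊥
    root-and-spoke i qi bi with
      roots-equal (there (Vecₚ.lookup⇒[]= i Q qi)) here ε (inj₂ (spoke i bi) ◅ ε)
    ... | ()

    Segment : ℕ → ℕ → Set
    Segment j k = ∀ m → j ≤ m → m < k → e m ≡ true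

    unit-segment : ∀ {k} → e k ≡ true → Segment k (suc k)
    unit-segment ek m k≤m (s≤s m≤k) = trans (cong e (ℕₚ.≤-antisym m≤k k≤m)) ek

    segment-path : ∀ {j} k → j ≤ k → Segment j k → Path (suc (walk j)) (suc (walk k))
    segment-path zero    z≤n _ = ε
    segment-path (suc k) j≤1+k segment with ℕₚ.m≤n⇒m<n∨m≡n j≤1+k
    ... | inj₂ refl      = ε
    ... | inj₁ (s≤s j≤k) =
      segment-path k j≤k (λ m j≤m m<k → segment m j≤m (ℕₚ.m<n⇒m<1+n m<k))
      ◅◅ (inj₁ (rim (walk k) (segment k j≤k ℕₚ.≤-refl)) ◅ ε)

    no-full-rim : ¬ Segment 0 N
    no-full-rim full =
      no-cycle 3≤N suc Finₚ.suc-injective λ i → inj₁ (rim i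
        (subst (λ j → lookup A j ≡ true) (walk-position i) (full (position i) z≤n (position<N i))))

    -- The cycle consists of the centre and the `2 + l` rim vertices of the segment. Writing the far
    -- end as `suc (j + l)` makes its length at least 3.
    no-spoke-cycle : ∀ j l → suc (j + l) < N → b j ≡ true → b (suc (j + l)) ≡ true →
                     ¬ Segment j (suc (j + l))
    no-spoke-cycle j l k<N bj bk segment =
      no-cycle (s≤s (s≤s (s≤s z≤n))) x x-injective adj
      where
      x : Fin (3 + l) → Fin (suc N)
      x zero    = centre
      x (suc m) = suc (walk (j + toℕ m))

      <k : (m : Fin (2 + l)) → j + toℕ m ≤ suc (j + l)
      <k m = ℕₚ.≤-trans (ℕₚ.+-monoʳ-≤ j (ℕₚ.≤-pred (Finₚ.toℕ<n m)))
        (ℕₚ.≤-reflexive (ℕₚ.+-suc j l))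

      x-injective : Injective _≡_ _≡_ x
      x-injective {zero}  {zero}   _  = refl
      x-injective {suc m} {suc m′} eq = cong suc (Finₚ.toℕ-injective (ℕₚ.+-cancelˡ-≡ j _ _
        (walk-injective (ℕₚ.≤-<-trans (<k m) k<N) (ℕₚ.≤-<-trans (<k m′) k<N)
          (Finₚ.suc-injective eq))))

      before-last : ∀ (m m′ : Fin (2 + l)) → toℕ m′ ≡ suc (toℕ m) → toℕ m ≤ l
      before-last m m′ p = ℕₚ.≤-pred (ℕₚ.≤-pred (subst (_< 2 + l) p (Finₚ.toℕ<n m′)))

      adj : ∀ i → Adj (x i) (x (next i))
      adj zero with next {3 + l} zero | next≡ {i = zero} {j = suc (zero {suc l})} refl
      ... | _ | refl = inj₁ (spoke _ (trans (cong b (ℕₚ.+-identityʳ j)) bj))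
      adj (suc m) with next (suc m) | next-cases (suc m)
      ... | suc m′ | inj₁ p rewrite ℕₚ.suc-injective p | ℕₚ.+-suc j (toℕ m) =
        inj₁ (rim _ (segment (j + toℕ m) (ℕₚ.m≤m+n j (toℕ m))
          (s≤s (ℕₚ.+-monoʳ-≤ j (before-last m m′ (ℕₚ.suc-injective p))))))
      ... | zero | inj₂ (_ , p) =
        inj₂ (spoke _ (trans
          (cong b (trans (cong (j +_) (ℕₚ.suc-injective (ℕₚ.suc-injective p))) (ℕₚ.+-suc j l))) bk))

    -- The walk is injective below `N`, so a return is possible only from 0 to `N`, and the segment
    -- would be the whole rim.
    no-return : ∀ {j k} → j < k → k ≤ N → Segment j k → walk j ≢ walk k
    no-return j<k k≤N segment eq with ℕₚ.m≤n⇒m<n∨m≡n k≤N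
    ... | inj₁ k<N  = ℕₚ.<⇒≢ j<k (walk-injective (ℕₚ.<-trans j<k k<N) k<N eq)
    ... | inj₂ refl with refl ← walk-injective j<k (s≤s z≤n) (trans eq walk-N) =
      no-full-rim segment

    -- Two vertices of R, or one and a spoke, put two roots into one component; two spokes close a
    -- cycle through the centre.
    two-marks : ∀ {j k} → j < k → k ≤ N → Segment j k → Marked (walk j) → Marked (walk k) → ⊥
    two-marks {j} {k} j<k k≤N segment mj mk with segment-path k (ℕₚ.<⇒≤ j<k) segment | mj | mk
    ... | π | inj₁ qj | inj₁ qk = no-return j<k k≤N segment (Finₚ.suc-injective
      (roots-equal (there (Vecₚ.lookup⇒[]= _ Q qj)) (there (Vecₚ.lookup⇒[]= _ Q qk)) ε π))
    ... | π | inj₁ qj | inj₂ bk = Finₚ.0≢1+n (sym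
      (roots-equal (there (Vecₚ.lookup⇒[]= _ Q qj)) here ε (π ◅◅ (inj₂ (spoke _ bk) ◅ ε))))
    ... | π | inj₂ bj | inj₁ qk = Finₚ.0≢1+n
      (roots-equal here (there (Vecₚ.lookup⇒[]= _ Q qk)) (inj₂ (spoke _ bj) ◅ ε) π)
    ... | _ | inj₂ bj | inj₂ bk with ℕₚ.m≤n⇒m<n∨m≡n k≤N | ℕₚ.m≤n⇒∃[o]m+o≡n j<k
    ...   | inj₁ k<N  | l , refl = no-spoke-cycle j l k<N bj bk segment
    -- At `k = N` the walk is back at `a`, a root, which cannot carry a spoke.
    ...   | inj₂ refl | _ =
      root-and-spoke a a∈Q (subst (λ i → lookup B i ≡ true) walk-N bk)

    Within : ℕ → ℕ → Fin (suc N) → Set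
    Within j k v = ∃[ m ] j < m × m ≤ k × v ≡ suc (walk m)

    Unmarked : ℕ → ℕ → Set
    Unmarked j k = ∀ m → j < m → m ≤ k → q m ≡ false × b m ≡ false

    module _ {j k : ℕ} (ej : e j ≡ false) (ek : e k ≡ false) (unmarked : Unmarked j k) where

      -- Both boundary rim edges are missing and no vertex of the arc has a spoke, so no edge leaves
      -- the arc.
      stays : ∀ {u v} → Adj u v → Within j k u → Within j k v
      stays (inj₁ (rim i i∈A)) (m , j<m , m≤k , refl) with ℕₚ.m≤n⇒m<n∨m≡n m≤k
      ... | inj₁ m<k  = suc m , ℕₚ.m<n⇒m<1+n j<m , m<k , refl
      ... | inj₂ refl = ⊥-elim (true≢false i∈A ek)
      stays (inj₂ (rim i i∈A)) (suc m , j<1+m , m<k , eq)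
        with refl ← next-injective (Finₚ.suc-injective eq) with ℕₚ.m≤n⇒m<n∨m≡n j<1+m
      ... | inj₁ (s≤s j<m) = m , j<m , ℕₚ.<⇒≤ m<k , refl
      ... | inj₂ refl      = ⊥-elim (true≢false i∈A ej)
      stays (inj₂ (spoke i i∈B)) (m , j<m , m≤k , refl) =
        ⊥-elim (true≢false i∈B (proj₂ (unmarked m j<m m≤k)))

      stays* : ∀ {u v} → Path u v → Within j k u → Within j k v
      stays* ε       w = w
      stays* (l ◅ p) w = stays* p (stays l w)

      -- The root of `walk k` would lie in the arc, which contains neither the centre nor a vertex
      -- of R.
      no-unmarked-arc : ¬ j < k
      no-unmarked-arc j<k with root (suc (walk k))
      ... | s , s∈S , p with stays* p (k , j<k , ℕₚ.≤-refl , refl)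
      ...   | m , j<m , m≤k , refl with there i∈Q ← s∈S =
        true≢false (Vecₚ.[]=⇒lookup i∈Q) (proj₁ (unmarked m j<m m≤k))

    -- The states of a run from `a`, made total by ignoring failure, which `walk-step` excludes
    -- afterwards. The start is `false` because a vertex of R accepts no other state.
    state : ℕ → Bool
    state zero    = false
    state (suc k) = e k ∧ (q k ∨ (b k ∨ state k))

    -- The witness is the nearest mark met when going back along present edges.
    state-true : ∀ k → state k ≡ true → ∃[ j ] j < k × Segment j k × Marked (walk j)
    state-true (suc k) s≡true
      with e k in ek | q k in qk | b k in bk | state k in sk
    ... | true | true  | _     | _    = k , ℕₚ.≤-refl , unit-segment ek , inj₁ qk
    ... | true | false | true  | _    = k , ℕₚ.≤-refl , unit-segment ek , inj₂ bk
    ... | true | false | false | true with j , j<k , segment , mj ← state-true k sk =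
      j , ℕₚ.m<n⇒m<1+n j<k , extended , mj
      where
      extended : Segment j (suc k)
      extended m j≤m (s≤s m≤k) with ℕₚ.m≤n⇒m<n∨m≡n m≤k
      ... | inj₁ m<k  = segment m j≤m m<k
      ... | inj₂ refl = ek

    -- The witness is the nearest missing edge behind `k`; the search ends before position 0 because
    -- `a` is marked.
    state-false : ∀ k → state k ≡ false → q k ≡ false → b k ≡ false →
                  ∃[ j ] j < k × e j ≡ false × Unmarked j k
    state-false zero    _       qk _  = ⊥-elim (true≢false a∈Q qk)
    state-false (suc k) s≡false qk bk
      with e k in ek | q k in qk′ | b k in bk′ | state k in sk
    ... | false | _ | _ | _ = k , ℕₚ.≤-refl , ek , last
      where
      last : Unmarked k (suc k)
      last m k<m m≤1+k with refl ← ℕₚ.≤-antisym k<m m≤1+k = qk , bk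
    ... | true | false | false | false with j , j<k , ej , unmarked ← state-false k sk qk′ bk′ =
      j , ℕₚ.m<n⇒m<1+n j<k , ej , extended
      where
      extended : Unmarked j (suc k)
      extended m j<m m≤1+k with ℕₚ.m≤n⇒m<n∨m≡n m≤1+k
      ... | inj₁ (s≤s m≤k) = unmarked m j<m m≤k
      ... | inj₂ refl      = qk , bk

    state-marked : ∀ k → k ≤ N → state k ≡ true → Marked (walk k) → ⊥
    state-marked k k≤N sk mk with j , j<k , segment , mj ← state-true k sk =
      two-marks j<k k≤N segment mj mk

    -- `step` fails for a root with a spoke, for a mark in state `true`, and for a component closed
    -- without a mark; each contradicts the forest.
    walk-step : ∀ k → k < N → step (q k) (b k) (e k) (state k) ≡ just (state (suc k))
    walk-step k k<N with q k in qk | b k in bk | e k in ek | state k in sk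
    ... | true  | true  | _     | _     = ⊥-elim (root-and-spoke _ qk bk)
    ... | true  | false | _     | true  = ⊥-elim (state-marked k (ℕₚ.<⇒≤ k<N) sk (inj₁ qk))
    ... | false | true  | _     | true  = ⊥-elim (state-marked k (ℕₚ.<⇒≤ k<N) sk (inj₂ bk))
    ... | true  | false | true  | false = refl
    ... | true  | false | false | false = refl
    ... | false | true  | true  | false = refl
    ... | false | true  | false | false = refl
    ... | false | false | true  | true  = refl
    ... | false | false | false | true  = refl
    ... | false | false | true  | false = refl
    ... | false | false | false | false with j , j<k , ej , unmarked ← state-false k sk qk bk =
      ⊥-elim (no-unmarked-arc ej ek unmarked j<k)

    -- State `true` here would connect an earlier mark to the root `a`, reached again. This lets the
    -- states close up cyclically.
    state-N : state N ≡ false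
    state-N with state N in sN
    ... | false = refl
    ... | true  = ⊥-elim (state-marked N ℕₚ.≤-refl sN
      (inj₁ (trans (cong (lookup Q) walk-N) a∈Q)))

    states : Fin N → Bool
    states i = state (position i)

    states-next : ∀ k → k < N → states (next (walk k)) ≡ state (suc k)
    states-next k k<N with ℕₚ.m≤n⇒m<n∨m≡n k<N
    ... | inj₁ 1+k<N = cong state (position-walk 1+k<N)
    ... | inj₂ refl  = trans (cong states walk-N)
      (trans (cong state (position-walk (s≤s z≤n))) (sym state-N))

    states-step : ∀ i → step (lookup Q i) (lookup B i) (lookup A i) (states i) ≡ just (states (next i))
    states-step i = subst
      (λ j → step (lookup Q j) (lookup B j) (lookup A j) (states i) ≡ just (states (next j)))
      (walk-position i)
      (trans (walk-step (position i) (position<N i))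
             (cong just (sym (states-next (position i) (position<N i)))))

-- Closed runs

run-states : (Q B A : Subset n) (τ : Fin (suc n) → Bool) →
  (∀ i → step (lookup Q i) (lookup B i) (lookup A i) (τ (inject₁ i)) ≡ just (τ (suc i))) →
  run Q B A (τ zero) ≡ just (τ (fromℕ n))
run-states []      []      []      τ steps = refl
run-states (q ∷ Q) (b ∷ B) (a ∷ A) τ steps rewrite steps zero =
  run-states Q B A (τ ∘ suc) (steps ∘ suc)

states-run : ∀ {n} (Q B A : Subset n) {s s′ : Bool} → run Q B A s ≡ just s′ →
  ∃ λ (τ : Fin (suc n) → Bool) → τ zero ≡ s × τ (fromℕ n) ≡ s′ ×
  (∀ i → step (lookup Q i) (lookup B i) (lookup A i) (τ (inject₁ i)) ≡ just (τ (suc i)))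
states-run []      []      []      {s} refl = (λ _ → s) , refl , refl , λ ()
states-run (q ∷ Q) (b ∷ B) (a ∷ A) {s} r with step q b a s in eq
... | just _ with τ , refl , last , steps ← states-run Q B A r =
  (λ { zero → s ; (suc i) → τ i }) , refl , last , λ { zero → eq ; (suc i) → steps i }

closed-run : (Q B A : Subset (suc n)) (t : Fin (suc n) → Bool) →
  (∀ i → step (lookup Q i) (lookup B i) (lookup A i) (t i) ≡ just (t (next i))) →
  run Q B A (t zero) ≡ just (t zero)
closed-run {n} Q B A t steps = trans
  -- Reduction modulo `suc n` repeats the first state after the last letter.
  (run-states Q B A (λ j → t (toℕ j mod suc n)) λ i →
    subst (λ j → step (lookup Q i) (lookup B i) (lookup A i) (t j) ≡ just (t (next i)))
          (sym (inject₁-mod i)) (steps i))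
  (cong (just ∘ t) last-mod)
  where
  inject₁-mod : ∀ i → toℕ (inject₁ i) mod suc n ≡ i
  inject₁-mod i = Finₚ.toℕ-injective (trans (Finₚ.toℕ-fromℕ< _)
    (trans (m<n⇒m%n≡m (Finₚ.inject₁ℕ< i)) (Finₚ.toℕ-inject₁ i)))
  last-mod : toℕ (fromℕ (suc n)) mod suc n ≡ zero
  last-mod = Finₚ.toℕ-injective (trans (Finₚ.toℕ-fromℕ< _)
    (trans (cong (_% suc n) (Finₚ.toℕ-fromℕ (suc n))) (n%n≡0 (suc n))))

closed-states : ∀ {n} (Q B A : Subset (suc n)) {s : Bool} → run Q B A s ≡ just s →
  ∃ λ (t : Fin (suc n) → Bool) → ∀ i →
  step (lookup Q i) (lookup B i) (lookup A i) (t i) ≡ just (t (next i))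
closed-states {n} Q B A r with τ , first , last , steps ← states-run Q B A r =
  τ ∘ inject₁ , λ i → trans (steps i) (cong just (wrap i (next-cases i)))
  where
  wrap : ∀ i → toℕ (next i) ≡ suc (toℕ i) ⊎ toℕ (next i) ≡ 0 × suc (toℕ i) ≡ suc n →
         τ (suc i) ≡ τ (inject₁ (next i))
  wrap i (inj₁ p) = cong τ (Finₚ.toℕ-injective (sym (trans (Finₚ.toℕ-inject₁ _) p)))
  wrap i (inj₂ (p , q)) = trans
    (cong τ (Finₚ.toℕ-injective (trans q (sym (Finₚ.toℕ-fromℕ (suc n))))))
    (trans last (trans (sym first)
      (cong τ (Finₚ.toℕ-injective (sym (trans (Finₚ.toℕ-inject₁ (next i)) p))))))

-- A vertex of R forgets the initial state.
run-confluent : (Q B A : Subset n) {i : Fin n} {s s′ : Bool} → i ∈ Q →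
  run Q B A false ≡ just s → run Q B A true ≡ just s′ → s ≡ s′
run-confluent (true ∷ Q)  (false ∷ B) (a ∷ A)     _           r ()
run-confluent (true ∷ Q)  (true ∷ B)  (a ∷ A)     _           ()
run-confluent (false ∷ Q) (true ∷ B)  (a ∷ A)     (there i∈Q) r ()
run-confluent (false ∷ Q) (false ∷ B) (true ∷ A)  (there i∈Q) r r′ = run-confluent Q B A i∈Q r r′
run-confluent (false ∷ Q) (false ∷ B) (false ∷ A) (there i∈Q) ()

-- The states found by walking from a vertex of R are attached to rim vertices and consistent
-- cyclically, so the run may be read from the first rim vertex instead.
rootedForest⇔closed-run : (3≤N : 3 ≤ suc n) (Q B A : Subset (suc n)) {i : Fin (suc n)} → i ∈ Q →
  IsRootedForest (wheel (suc n) 3≤N) (inside ∷ Q) (A ++ B) ⇔ (∃[ s ] run Q B A s ≡ just s)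
rootedForest⇔closed-run 3≤N Q B A {a} a∈Q = mk⇔
  (λ forest → _ , closed-run Q B A _ (FromForest.states-step forest))
  (λ { (s , r) → let t , steps = closed-states Q B A r in FromStates.rootedForest t steps })
  where open Wheel 3≤N Q B A a (Vecₚ.[]=⇒lookup a∈Q)

-- The number of forests as a trace

hit-≢ : ∀ r s → r ≢ just s → hit r s ≡ 0
hit-≢ nothing      s     _    = refl
hit-≢ (just true)  true  ≢s   = contradiction refl ≢s
hit-≢ (just true)  false _    = refl
hit-≢ (just false) true  _    = refl
hit-≢ (just false) false ≢s   = contradiction refl ≢s

-- By `run-confluent` at most one initial state gives a closed run, so the two diagonal hits never
-- count a forest twice.
indicator-closed-run : (Q B A : Subset n) {i : Fin n} → i ∈ Q →
  {P : Set} (P? : Dec P) → P ⇔ (∃[ s ] run Q B A s ≡ just s) →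
  ⟦ does P? ⟧ ≡ hit (run Q B A false) false + hit (run Q B A true) true
indicator-closed-run Q B A i∈Q (no ¬p) P⇔ = sym (cong₂ _+_ (miss false) (miss true))
  where
  miss : ∀ s → hit (run Q B A s) s ≡ 0
  miss s = hit-≢ _ s λ r → ¬p (Equivalence.from P⇔ (s , r))
indicator-closed-run Q B A i∈Q (yes p) P⇔ with Equivalence.to P⇔ p
... | false , r rewrite r = sym (cong suc
  (hit-≢ (run Q B A true) true λ r′ → contradiction (run-confluent Q B A i∈Q r r′) λ ()))
... | true  , r rewrite r = sym (cong (_+ 1)
  (hit-≢ (run Q B A false) false λ r′ → contradiction (run-confluent Q B A i∈Q r′ r) λ ()))

forest-count : (3≤N : 3 ≤ n) (Q : Subset n) {i : Fin n} → i ∈ Q →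
  𝓕 (wheel n 3≤N) (inside ∷ Q) ≡ ∑run Q (just false) false + ∑run Q (just true) true
forest-count {n@(suc _)} 3≤N Q i∈Q = begin
  𝓕 G (inside ∷ Q)
    ≡⟨ count≡∑ forest? ⟩
  ∑ (n + n) (λ F → ⟦ does (forest? F) ⟧)
    -- The first `n` edges of the wheel are the rim, the last `n` the spokes.
    ≡⟨ ∑-++ n (λ F → ⟦ does (forest? F) ⟧) ⟩
  (∑ n λ A → ∑ n λ B → ⟦ does (forest? (A ++ B)) ⟧)
    ≡⟨ (∑-cong n λ A → ∑-cong n λ B → indicator-closed-run Q B A i∈Q (forest? (A ++ B))
          (rootedForest⇔closed-run 3≤N Q B A i∈Q)) ⟩
  (∑ n λ A → ∑ n λ B → hit (run Q B A false) false + hit (run Q B A true) true)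
    ≡⟨ (∑-cong n λ A →
          ∑-+ n (λ B → hit (run Q B A false) false) (λ B → hit (run Q B A true) true)) ⟩
  (∑ n λ A → (∑ n λ B → hit (run Q B A false) false) + (∑ n λ B → hit (run Q B A true) true))
    ≡⟨ ∑-+ n (λ A → ∑ n λ B → hit (run Q B A false) false)
             (λ A → ∑ n λ B → hit (run Q B A true) true) ⟩
  ∑run Q (just false) false + ∑run Q (just true) true ∎
  where
  open ≡-Reasoning
  G = wheel n 3≤N
  forest? : Decidable (IsRootedForest G (inside ∷ Q))
  forest? = isRootedForest? G (inside ∷ Q)

0<∣p∣⇒nonempty : (p : Subset n) → 1 ≤ ∣ p ∣ → Nonempty p
0<∣p∣⇒nonempty {n} p 1≤∣p∣ with nonempty? p
... | yes nonempty = nonempty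
... | no  empty    = contradiction
  (ℕₚ.≤-trans 1≤∣p∣ (ℕₚ.≤-reflexive (trans (cong ∣_∣ (Empty-unique empty)) (∣⊥∣≡0 n)))) λ ()

corollary3p7 : (N r : ℕ) (3≤N : 3 ≤ N) → 1 ≤ r → r ≤ N →
    (R : Subset (suc N)) → centre ∉ R → ∣ R ∣ ≡ r →
    𝓕 (wheel N 3≤N) (⁅ centre ⁆ ∪ R) ≡
    product (map (λ d → m (path (2 * d ∸ 1))) (cyclicIntervals R))
corollary3p7 N r 3≤N 1≤r r≤N (inside ∷ Q)  c∉R ∣R∣≡r = contradiction here c∉R
corollary3p7 N r 3≤N 1≤r r≤N (outside ∷ Q) c∉R refl =
  let i , i∈Q = 0<∣p∣⇒nonempty Q 1≤r in
  -- The union computes to `inside` in front of the empty set joined with `Q`.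
  trans (cong (λ Q′ → 𝓕 (wheel N 3≤N) (inside ∷ Q′)) (∪-identityˡ Q))
        (trans (forest-count 3≤N Q i∈Q) (trace≡product Q i∈Q))
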